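{- Let $n\ge1$ and $r\ge0$ be integers. Then $$\bar M^{(n)}_{2r}(0;2)=\frac{2^{2r-1}n\binom{2n}{n}}{\binom{2r+2n-2}{r+n-1}}-2(n-1).$$
   Context: A walk is a lattice path in $\mathbb Z^2$ with steps $(1,1)$ and $(1,-1)$ never going below the $x$-axis. A family of walks is vicious if no two of its walks share a lattice point. A contact is a lattice point on the $x$-axis lying on one of the walks (starting and end points included); $c(\mathbf P)$ is the total number of contacts of a family $\mathbf P$. $Z^{(n)}_t(y;\kappa)=\sum_{\mathbf P}\kappa^{c(\mathbf P)}$, summed over vicious families $(P_1,\dots,P_n)$ with $P_i$ running from $(0,2i-2)$ to $(t,y+2i-2)$. The normalized mean number of contacts is $\bar M^{(n)}_t(y;\kappa)=\kappa\frac{d}{d\kappa}Z^{(n)}_t(y;\kappa)\big/Z^{(n)}_t(y;\kappa)$. -}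

module Defs where

open import Data.Bool using (Bool; true; false; _∧_; if_then_else_)
open import Data.Nat as ℕ using (ℕ; zero; suc; _+_; _*_; _^_)
open import Data.Integer as ℤ using (ℤ; +_; -[1+_])
import Data.Integer.Properties as ℤP
open import Data.Rational as ℚ using (ℚ)
open import Data.List using (List; []; _∷_; map; concatMap; filter; length)
open import Data.Nat.ListAction using (sum)
open import Data.Bool.ListAction using (and)
open import Data.Vec using (Vec; []; _∷_)
open import Relation.Nullary.Decidable using (⌊_⌋)

-- A step: true = (1,1) (up), false = (1,-1) (down).
Step : Set
Step = Bool

-- A walk of length t is its sequence of t steps together with its start height.
-- heights h s = heights of the walk at x = 0, 1, …, t (length t+1).
heights : {t : ℕ} → ℤ → Vec Step t → List ℤ
heights h []            = h ∷ []
heights h (true  ∷ s)   = h ∷ heights (h ℤ.+ ℤ.1ℤ) s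
heights h (false ∷ s)   = h ∷ heights (h ℤ.- ℤ.1ℤ) s

last : ℤ → List ℤ → ℤ
last d []       = d
last d (x ∷ []) = x
last d (_ ∷ x ∷ xs) = last d (x ∷ xs)

allSteps : (t : ℕ) → List (Vec Step t)
allSteps zero    = [] ∷ []
allSteps (suc t) = concatMap (λ s → (true ∷ s) ∷ (false ∷ s) ∷ []) (allSteps t)

allFamilies : (n t : ℕ) → List (Vec (Vec Step t) n)
allFamilies zero    t = [] ∷ []
allFamilies (suc n) t = concatMap (λ f → map (λ s → s ∷ f) (allSteps t)) (allFamilies n t)

-- height sequences of a family, walk number k (k = 0,…,n-1, i.e. P_{k+1})
-- starting at height 2k
familyHeights : {n t : ℕ} → ℕ → Vec (Vec Step t) n → List (List ℤ)
familyHeights k []      = []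
familyHeights k (s ∷ f) = heights (+ (2 * k)) s ∷ familyHeights (suc k) f

nonneg : List ℤ → Bool
nonneg hs = and (map (λ h → ⌊ ℤ.0ℤ ℤ.≤? h ⌋) hs)

-- two height sequences (same x-coordinates 0..t) share no lattice point
disjoint : List ℤ → List ℤ → Bool
disjoint []       _        = true
disjoint (_ ∷ _)  []       = true
disjoint (a ∷ as) (b ∷ bs) = (if ⌊ a ℤ.≟ b ⌋ then false else true) ∧ disjoint as bs

pairwiseDisjoint : List (List ℤ) → Bool
pairwiseDisjoint []       = true
pairwiseDisjoint (h ∷ hs) = and (map (disjoint h) hs) ∧ pairwiseDisjoint hs

validWalks : ℕ → ℕ → List (List ℤ) → Bool
validWalks y k []        = true
validWalks y k (hs ∷ hss) =
  nonneg hs ∧ ⌊ last ℤ.0ℤ hs ℤ.≟ + (y + 2 * k) ⌋ ∧ validWalks y (suc k) hss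

isVicious : {n t : ℕ} → ℕ → Vec (Vec Step t) n → Bool
isVicious y f = validWalks y 0 (familyHeights 0 f) ∧ pairwiseDisjoint (familyHeights 0 f)

contacts : {n t : ℕ} → Vec (Vec Step t) n → ℕ
contacts f = sum (map (λ hs → length (filter (λ h → h ℤ.≟ ℤ.0ℤ) hs)) (familyHeights 0 f))

viciousFamilies : (n t y : ℕ) → List (Vec (Vec Step t) n)
viciousFamilies n t y = filter (λ f → Relation.Nullary.Decidable.T? (isVicious y f)) (allFamilies n t)
  where import Relation.Nullary.Decidable

Z : (n t y κ : ℕ) → ℕ
Z n t y κ = sum (map (λ f → κ ^ contacts f) (viciousFamilies n t y))

-- κ (d/dκ) Z^{(n)}_t(y;κ) = Σ_P c(P) κ^{c(P)}
κdZ : (n t y κ : ℕ) → ℕ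
κdZ n t y κ = sum (map (λ f → contacts f * κ ^ contacts f) (viciousFamilies n t y))

-- total division of naturals into ℚ (only used with nonzero denominators)
_÷ℕ_ : ℤ → ℕ → ℚ
p ÷ℕ zero  = ℚ.0ℚ
p ÷ℕ suc d = p ℚ./ suc d

Mbar : (n t y κ : ℕ) → ℚ
Mbar n t y κ = (+ κdZ n t y κ) ÷ℕ Z n t y κ

{-# OPTIONS --safe #-}
-- Only the lowest walk meets the axis, and at κ = 2 + 2ε the generating function is Z + ε κ dZ/dκ.
-- By a Lindström–Gessel–Viennot argument it is, up to a power of κ, a determinant whose columns are
-- indexed by the lengths 2(r + j). To first order in ε the entries are 2 C(2m , m - i) + 2ε 4^m with
-- m = r + j, after row operations that contribute the factor (1 + ε)^(n-1): a rank-one perturbation.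
-- A combination of the columns that is constant in i, with value T + ε S, makes the determinant
-- proportional to T + ε S, so the mean is S / T - 2 (n - 1), the factors κ^(n-1) and (1 + ε)^(n-1)
-- accounting for n - 1 each. The combination is an (n-1)-st finite difference after rescaling the columns
-- so that 2 C(2m , m - i) becomes a polynomial in m of degree n - 1 with a leading coefficient independent
-- of i; the rescaled 4^m is a hypergeometric term whose differences are again such terms.
module Submission where

open import Defs

-- Only the first derivative at κ = 2 is wanted, so the algebra takes place in ℤ[ε]/(ε²). The
-- determinant is never evaluated: once T + ε S has been split off, the cofactor is free of ε, and
-- comparing the real with the infinitesimal parts eliminates it. Divisions are avoided throughout.
-- The shift by the rank-one term is made after multiplying each column by T, closed forms are
-- cleared of their factorials, and a nonzero integer is cancelled at the end. The weight κ = 2 is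
-- special because the axis then acts as a reflection, so that weighted counts of restricted walks
-- are twice the counts of free ones. Prolonging every walk down to the axis makes each entry a
-- count of walks ending at height 0, which is a single binomial coefficient. The price is one
-- spurious contact for each of the n - 1 upper walks, whence the power of κ. Crossing-free geometry
-- enters only through parity: the gaps between neighbours are even, so walks meet before they
-- cross, and a recurrence in t replaces the usual sign-reversing involution.

-- The ring of dual numbers ℤ[ε]/(ε²).

module DualNumbers where
  open import Algebra.Bundles using (CommutativeRing)
  open import Data.Maybe using (Maybe; just; nothing)
  open import Data.Product using (_,_)
  open import Data.Nat using (ℕ; zero; suc)
  open import Data.Integer as ℤ using (ℤ; +_)
  import Data.Integer.Properties as ℤ
  import Data.Integer.Tactic.RingSolver as ℤ-Solver
  open import Level using (0ℓ)
  open import Relation.Binary.PropositionalEquality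
  open import Tactic.RingSolver.Core.AlmostCommutativeRing using (AlmostCommutativeRing; fromCommutativeRing)

  data Dual : Set where
    _+ε_ : ℤ → ℤ → Dual

  infix 5 _+ε_

  re ep : Dual → ℤ
  re (a +ε b) = a
  ep (a +ε b) = b

  infixl 6 _+_ _-_
  infixl 7 _*_
  infix  8 -_

  _+_ _*_ : Dual → Dual → Dual
  (a +ε b) + (c +ε d) = a ℤ.+ c +ε b ℤ.+ d
  (a +ε b) * (c +ε d) = a ℤ.* c +ε a ℤ.* d ℤ.+ b ℤ.* c

  -_ : Dual → Dual
  - (a +ε b) = ℤ.- a +ε ℤ.- b

  _-_ : Dual → Dual → Dual
  x - y = x + - y

  0# 1# : Dual
  0# = + 0 +ε + 0
  1# = + 1 +ε + 0

  private
    mul-assoc : ∀ a b c d e f → (a ℤ.* c) ℤ.* f ℤ.+ (a ℤ.* d ℤ.+ b ℤ.* c) ℤ.* e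
                ≡ a ℤ.* (c ℤ.* f ℤ.+ d ℤ.* e) ℤ.+ b ℤ.* (c ℤ.* e)
    mul-assoc = ℤ-Solver.solve-∀

    mul-comm : ∀ a b c d → a ℤ.* d ℤ.+ b ℤ.* c ≡ c ℤ.* b ℤ.+ d ℤ.* a
    mul-comm = ℤ-Solver.solve-∀

    mul-distrib : ∀ a b c d e f → a ℤ.* (d ℤ.+ f) ℤ.+ b ℤ.* (c ℤ.+ e)
                  ≡ (a ℤ.* d ℤ.+ b ℤ.* c) ℤ.+ (a ℤ.* f ℤ.+ b ℤ.* e)
    mul-distrib = ℤ-Solver.solve-∀

    mul-one : ∀ a b → + 1 ℤ.* b ℤ.+ + 0 ℤ.* a ≡ b
    mul-one = ℤ-Solver.solve-∀

  +-assoc : ∀ x y z → (x + y) + z ≡ x + (y + z)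
  +-assoc (a +ε b) (c +ε d) (e +ε f) = cong₂ _+ε_ (ℤ.+-assoc a c e) (ℤ.+-assoc b d f)

  +-comm : ∀ x y → x + y ≡ y + x
  +-comm (a +ε b) (c +ε d) = cong₂ _+ε_ (ℤ.+-comm a c) (ℤ.+-comm b d)

  +-identityˡ : ∀ x → 0# + x ≡ x
  +-identityˡ (a +ε b) = cong₂ _+ε_ (ℤ.+-identityˡ a) (ℤ.+-identityˡ b)

  +-inverseˡ : ∀ x → - x + x ≡ 0#
  +-inverseˡ (a +ε b) = cong₂ _+ε_ (ℤ.+-inverseˡ a) (ℤ.+-inverseˡ b)

  *-assoc : ∀ x y z → (x * y) * z ≡ x * (y * z)
  *-assoc (a +ε b) (c +ε d) (e +ε f) = cong₂ _+ε_ (ℤ.*-assoc a c e) (mul-assoc a b c d e f)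

  *-comm : ∀ x y → x * y ≡ y * x
  *-comm (a +ε b) (c +ε d) = cong₂ _+ε_ (ℤ.*-comm a c) (mul-comm a b c d)

  *-identityˡ : ∀ x → 1# * x ≡ x
  *-identityˡ (a +ε b) = cong₂ _+ε_ (ℤ.*-identityˡ a) (mul-one a b)

  *-distribˡ-+ : ∀ x y z → x * (y + z) ≡ x * y + x * z
  *-distribˡ-+ (a +ε b) (c +ε d) (e +ε f) = cong₂ _+ε_ (ℤ.*-distribˡ-+ a c e) (mul-distrib a b c d e f)

  dualRing : CommutativeRing 0ℓ 0ℓ
  dualRing = record
    { Carrier = Dual ; _≈_ = _≡_ ; _+_ = _+_ ; _*_ = _*_ ; -_ = λ x → - x ; 0# = 0# ; 1# = 1#
    ; isCommutativeRing = record
      { isRing = record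
        { +-isAbelianGroup = record
          { isGroup = record
            { isMonoid = record
              { isSemigroup = record
                { isMagma = isMagma _+_ ; assoc = +-assoc }
              ; identity = +-identityˡ , λ x → trans (+-comm x 0#) (+-identityˡ x) }
            ; inverse = +-inverseˡ , λ x → trans (+-comm x (- x)) (+-inverseˡ x)
            ; ⁻¹-cong = cong (λ x → - x) }
          ; comm = +-comm }
        ; *-cong = cong₂ _*_
        ; *-assoc = *-assoc
        ; *-identity = *-identityˡ , λ x → trans (*-comm x 1#) (*-identityˡ x)
        ; distrib = *-distribˡ-+ , λ x y z → trans (*-comm (y + z) x)
                      (trans (*-distribˡ-+ x y z) (cong₂ _+_ (*-comm x y) (*-comm x z))) }
      ; *-comm = *-comm } }

  0#≟ : ∀ x → Maybe (0# ≡ x)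
  0#≟ (+ 0 +ε + 0) = just refl
  0#≟ _            = nothing

  solverRing : AlmostCommutativeRing 0ℓ 0ℓ
  solverRing = fromCommutativeRing dualRing 0#≟

  infixr 8 _^ᵈ_
  _^ᵈ_ : Dual → ℕ → Dual
  x ^ᵈ zero  = 1#
  x ^ᵈ suc n = x * x ^ᵈ n

-- Determinants as iterated contractions; row and column operations.

module Determinants where
  open DualNumbers
  import Tactic.RingSolver as Solver
  open import Data.Nat as ℕ using (ℕ; zero; suc; s≤s)
  import Data.Nat.Properties as ℕ
  open import Data.Integer as ℤ using (+_)
  import Data.Integer.Properties as ℤ
  open import Data.List using (List; []; _∷_; _++_; map; applyUpTo)
  open import Data.List.Relation.Unary.All using (All; []; _∷_)
  open import Data.List.Relation.Unary.Any using (Any; here; there)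
  open import Data.Product using (∃; _×_; _,_)
  open import Function using (_∘_)
  open import Relation.Binary.PropositionalEquality
  open ≡-Reasoning

  module Contraction {X : Set} where

    Form : Set
    Form = List X → Dual

    -- This is the interior product: with a list read as the exterior product of its members,
    -- `ι φ F` is F applied after contraction with φ, and the second clause is the antiderivation
    -- rule. The sign rules are proved for ι itself, so that no permutations occur.
    ι : (X → Dual) → Form → Form
    ι φ F []       = 0#
    ι φ F (x ∷ xs) = φ x * F xs - ι φ (λ ys → F (x ∷ ys)) xs

    -- Columns are functions on X and rows are points of X; the expansion is along the first column.
    det : List (X → Dual) → Form
    det []       []      = 1#
    det []       (_ ∷ _) = 0#
    det (φ ∷ φs) xs      = ι φ (det φs) xs

    private
      linˡ : ∀ c u v f i j → (u + c * v) * f - (i + c * j) ≡ (u * f - i) + c * (v * f - j)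
      linˡ = Solver.solve-∀ solverRing
      linʳ : ∀ a b u f g i j → u * (a * f + b * g) - (a * i + b * j) ≡ a * (u * f - i) + b * (u * g - j)
      linʳ = Solver.solve-∀ solverRing
      sq : ∀ u i → u * i - (u * i + - 1# * 0#) ≡ 0#
      sq = Solver.solve-∀ solverRing
      anti : ∀ u v i j k → u * i - (v * j + - 1# * k) ≡ - (v * j - (u * i + - 1# * - k))
      anti = Solver.solve-∀ solverRing
      zero-sub : ∀ u → u * 0# - 0# ≡ 0#
      zero-sub = Solver.solve-∀ solverRing
      zero-head : ∀ u → 0# * u - 0# ≡ 0#
      zero-head = Solver.solve-∀ solverRing
      nil-lin : ∀ a b → 0# ≡ a * 0# + b * 0#
      nil-lin = Solver.solve-∀ solverRing
      nil-lin₁ : ∀ c → 0# ≡ 0# + c * 0#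
      nil-lin₁ = Solver.solve-∀ solverRing
      row : ∀ a b u v f i j → (a * u + b * v) * f - (a * i + b * j) ≡ a * (u * f - i) + b * (v * f - j)
      row = Solver.solve-∀ solverRing
      repeat : ∀ u f → u * f - (u * f - 0#) ≡ 0#
      repeat = Solver.solve-∀ solverRing
      sub : ∀ u f i → u * f - i ≡ u * f + - 1# * i
      sub = Solver.solve-∀ solverRing

    ι-cong : ∀ {φ ψ F G} → (∀ x → φ x ≡ ψ x) → (∀ xs → F xs ≡ G xs) → ∀ xs → ι φ F xs ≡ ι ψ G xs
    ι-cong p q []       = refl
    ι-cong p q (x ∷ xs) = cong₂ _-_ (cong₂ _*_ (p x) (q xs)) (ι-cong p (λ ys → q (x ∷ ys)) xs)

    ι-linearˡ : ∀ {φ ψ χ c F} → (∀ x → χ x ≡ φ x + c * ψ x) → ∀ xs → ι χ F xs ≡ ι φ F xs + c * ι ψ F xs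
    ι-linearˡ {c = c} h [] = nil-lin₁ c
    ι-linearˡ {φ} {ψ} {c = c} {F} h (x ∷ xs) =
      trans (cong₂ (λ u i → u * F xs - i) (h x) (ι-linearˡ h xs))
            (linˡ c (φ x) (ψ x) (F xs) _ _)

    ι-linearʳ : ∀ {φ a b F G H} → (∀ xs → H xs ≡ a * F xs + b * G xs) →
                ∀ xs → ι φ H xs ≡ a * ι φ F xs + b * ι φ G xs
    ι-linearʳ {a = a} {b} h [] = nil-lin a b
    ι-linearʳ {φ} {a} {b} {F} {G} h (x ∷ xs) =
      trans (cong₂ (λ f i → φ x * f - i) (h xs) (ι-linearʳ (λ ys → h (x ∷ ys)) xs))
            (linʳ a b (φ x) (F xs) (G xs) _ _)

    ι-zeroʳ : ∀ {φ F} → (∀ xs → F xs ≡ 0#) → ∀ xs → ι φ F xs ≡ 0#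
    ι-zeroʳ h [] = refl
    ι-zeroʳ {φ} h (x ∷ xs) =
      trans (cong₂ (λ f i → φ x * f - i) (h xs) (ι-zeroʳ (λ ys → h (x ∷ ys)) xs)) (zero-sub (φ x))

    ι-zeroˡ : ∀ {φ F} xs → All (λ x → φ x ≡ 0#) xs → ι φ F xs ≡ 0#
    ι-zeroˡ [] [] = refl
    ι-zeroˡ {F = F} (x ∷ xs) (p ∷ ps) =
      trans (cong₂ (λ u i → u * F xs - i) p (ι-zeroˡ xs ps)) (zero-head (F xs))

    -- The two terms pairing the head with the outer and with the inner φ cancel, which leaves the
    -- same square on the tail.
    ι-square : ∀ {φ} F xs → ι φ (ι φ F) xs ≡ 0#
    ι-square F [] = refl
    ι-square {φ} F (x ∷ xs) = begin
      φ x * ι φ F xs - ι φ (λ ys → φ x * F ys - ι φ F′ ys) xs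
        ≡⟨ cong (λ i → φ x * ι φ F xs - i) (ι-linearʳ (λ ys → sub (φ x) (F ys) (ι φ F′ ys)) xs) ⟩
      φ x * ι φ F xs - (φ x * ι φ F xs + - 1# * ι φ (ι φ F′) xs)
        ≡⟨ cong (λ i → φ x * ι φ F xs - (φ x * ι φ F xs + - 1# * i)) (ι-square F′ xs) ⟩
      φ x * ι φ F xs - (φ x * ι φ F xs + - 1# * 0#)
        ≡⟨ sq (φ x) (ι φ F xs) ⟩
      0# ∎
      where
      F′ : Form
      F′ ys = F (x ∷ ys)

    ι-anticomm : ∀ {φ ψ} F xs → ι φ (ι ψ F) xs ≡ - ι ψ (ι φ F) xs
    ι-anticomm F [] = refl
    ι-anticomm {φ} {ψ} F (x ∷ xs) = begin
      φ x * ι ψ F xs - ι φ (λ ys → ψ x * F ys - ι ψ F′ ys) xs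
        ≡⟨ cong (λ i → φ x * ι ψ F xs - i) (ι-linearʳ (λ ys → sub (ψ x) (F ys) (ι ψ F′ ys)) xs) ⟩
      φ x * ι ψ F xs - (ψ x * ι φ F xs + - 1# * ι φ (ι ψ F′) xs)
        ≡⟨ anti (φ x) (ψ x) (ι ψ F xs) (ι φ F xs) (ι φ (ι ψ F′) xs) ⟩
      - (ψ x * ι φ F xs - (φ x * ι ψ F xs + - 1# * - ι φ (ι ψ F′) xs))
        ≡⟨ cong (λ i → - (ψ x * ι φ F xs - (φ x * ι ψ F xs + - 1# * i))) (ι-anticomm {ψ} {φ} F′ xs) ⟨
      - (ψ x * ι φ F xs - (φ x * ι ψ F xs + - 1# * ι ψ (ι φ F′) xs))
        ≡⟨ cong (λ i → - (ψ x * ι φ F xs - i)) (ι-linearʳ (λ ys → sub (φ x) (F ys) (ι φ F′ ys)) xs) ⟨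
      - (ψ x * ι φ F xs - ι ψ (λ ys → φ x * F ys - ι φ F′ ys) xs) ∎
      where
      F′ : Form
      F′ ys = F (x ∷ ys)

    -- Anticommutation carries φ inward to its copy, where the square vanishes.
    ι-repeat : ∀ {φ φs} → Any (λ ψ → ψ ≡ φ) φs → ∀ xs → ι φ (det φs) xs ≡ 0#
    ι-repeat {φs = φ ∷ φs} (here refl) xs = ι-square (det φs) xs
    ι-repeat {φ} {ψ ∷ φs} (there m) xs = trans (ι-anticomm (det φs) xs)
      (cong (λ i → - i) (ι-zeroʳ (ι-repeat m) xs))

    det-zero-row : ∀ {φs x} → All (λ φ → φ x ≡ 0#) φs → ∀ xs → det φs (x ∷ xs) ≡ 0#
    det-zero-row [] xs = refl
    det-zero-row {φ ∷ φs} (p ∷ ps) xs =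
      trans (cong₂ (λ u i → u * det φs xs - i) p (ι-zeroʳ (det-zero-row ps) xs)) (zero-head _)

    -- X carries no linear structure, so linearity in a row is recorded by its effect on a form;
    -- that z is the combination of x and y is then required only of the values of the columns.
    SplitsAt : Dual → Dual → X → X → X → Form → Set
    SplitsAt a b x y z F = ∀ p q → F (p ++ z ∷ q) ≡ a * F (p ++ x ∷ q) + b * F (p ++ y ∷ q)

    ι-splits : ∀ {a b x y z φ F} → φ z ≡ a * φ x + b * φ y → SplitsAt a b x y z F → SplitsAt a b x y z (ι φ F)
    ι-splits {a} {b} {x} {y} {z} {φ} {F} h s [] q =
      trans (cong₂ (λ u i → u * F q - i) h (ι-linearʳ (s []) q))
            (row a b (φ x) (φ y) (F q) _ _)
    ι-splits {a} {b} {φ = φ} h s (w ∷ p) q =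
      trans (cong₂ (λ f i → φ w * f - i) (s p q) (ι-splits h (λ p′ → s (w ∷ p′)) p q))
            (linʳ a b (φ w) _ _ _ _)

    det-splits : ∀ {a b x y z φs} → All (λ φ → φ z ≡ a * φ x + b * φ y) φs → SplitsAt a b x y z (det φs)
    det-splits {a} {b} [] []      q = nil-lin a b
    det-splits {a} {b} [] (_ ∷ _) q = nil-lin a b
    det-splits (h ∷ hs)           = ι-splits h (det-splits hs)

    Alternating : Form → Set
    Alternating F = ∀ p x q → F (p ++ x ∷ x ∷ q) ≡ 0#

    ι-alternating : ∀ {φ F} → Alternating F → Alternating (ι φ F)
    ι-alternating {φ} {F} alt [] x q =
      trans (cong (λ i → φ x * F (x ∷ q) - (φ x * F (x ∷ q) - i)) (ι-zeroʳ (alt [] x) q))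
            (repeat (φ x) (F (x ∷ q)))
    ι-alternating {φ} alt (w ∷ p) x q =
      trans (cong₂ (λ f i → φ w * f - i) (alt p x q) (ι-alternating (λ p′ → alt (w ∷ p′)) p x q))
            (zero-sub (φ w))

    det-alternating : ∀ φs → Alternating (det φs)
    det-alternating []       []      x q = refl
    det-alternating []       (_ ∷ _) x q = refl
    det-alternating (φ ∷ φs)             = ι-alternating (det-alternating φs)

    private
      scale : ∀ α β f → α * f + β * 0# ≡ α * f
      scale = Solver.solve-∀ solverRing
      pow-step : ∀ α f p → α * (p * f) ≡ α * p * f
      pow-step = Solver.solve-∀ solverRing
      one : ∀ f → f ≡ 1# * f
      one = Solver.solve-∀ solverRing

    -- The contribution of the preceding row cancels, since that row is already present.
    bidiagonal-rows : ∀ {α β F} {x z : ℕ → X} → (∀ i → SplitsAt α β (x (suc i)) (x i) (z i) F) →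
                      Alternating F → ∀ n →
                      F (x 0 ∷ applyUpTo z n) ≡ α ^ᵈ n * F (applyUpTo x (suc n))
    bidiagonal-rows s alt zero = one _
    bidiagonal-rows {α} {β} {F} {x} {z} s alt (suc n) = begin
      F (x 0 ∷ z 0 ∷ zs)
        ≡⟨ s 0 (x 0 ∷ []) zs ⟩
      α * F (x 0 ∷ x 1 ∷ zs) + β * F (x 0 ∷ x 0 ∷ zs)
        ≡⟨ cong (λ f → α * F (x 0 ∷ x 1 ∷ zs) + β * f) (alt [] (x 0) zs) ⟩
      α * F (x 0 ∷ x 1 ∷ zs) + β * 0#
        ≡⟨ scale α β _ ⟩
      α * F (x 0 ∷ x 1 ∷ zs)
        ≡⟨ cong (α *_) (bidiagonal-rows {F = λ ys → F (x 0 ∷ ys)} (λ i p → s (suc i) (x 0 ∷ p)) (λ p → alt (x 0 ∷ p)) n) ⟩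
      α * (α ^ᵈ n * F (applyUpTo x (suc (suc n))))
        ≡⟨ pow-step α _ (α ^ᵈ n) ⟩
      α * α ^ᵈ n * F (applyUpTo x (suc (suc n))) ∎
      where zs = applyUpTo (z ∘ suc) n

  module _ {X Y : Set} (f : Y → X) where
    open Contraction

    ι-map : ∀ φ F xs → ι φ F (map f xs) ≡ ι (φ ∘ f) (F ∘ map f) xs
    ι-map φ F []       = refl
    ι-map φ F (x ∷ xs) = cong (λ i → φ (f x) * F (map f xs) - i) (ι-map φ (λ ys → F (f x ∷ ys)) xs)

    det-map : ∀ φs xs → det φs (map f xs) ≡ det (map (_∘ f) φs) xs
    det-map []       []      = refl
    det-map []       (_ ∷ _) = refl
    det-map (φ ∷ φs) xs      = trans (ι-map φ (det φs) xs) (ι-cong (λ _ → refl) (det-map φs) xs)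

  Δ : ℕ → (ℕ → Dual) → ℕ → Dual
  Δ zero    f j = f j
  Δ (suc k) f j = Δ k f (suc j) - Δ k f j

  -- The cofactor will be known only to have this shape; matching on `real` exposes the integer that
  -- is eliminated later.
  data Real : Dual → Set where
    real : ∀ a → Real (a +ε + 0)

  sum-real : ∀ {x y} → Real x → Real y → Real (x - y)
  sum-real (real a) (real b) = real (a ℤ.+ ℤ.- b)

  product-real : ∀ {x y} → Real x → Real y → Real (x * y)
  product-real (real a) (real b) = subst Real (cong (a ℤ.* b +ε_) (sym (cong (ℤ._+ + 0) (ℤ.*-zeroʳ a)))) (real (a ℤ.* b))

  module ColumnOperations {X : Set} where
    open Contraction {X}

    private
      scale-ring : ∀ c u f i → c * u * f - c * i ≡ c * (u * f - i)
      scale-ring = Solver.solve-∀ solverRing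
      nil : ∀ c → 0# ≡ c * 0#
      nil = Solver.solve-∀ solverRing
      swap : ∀ c u f → u * (c * f) ≡ c * u * f
      swap = Solver.solve-∀ solverRing
      sub : ∀ u v → u - v ≡ u + - 1# * v
      sub = Solver.solve-∀ solverRing
      sign : ∀ s e d → 0# + - 1# * (s * e * d) ≡ (- 1# * s) * e * d
      sign = Solver.solve-∀ solverRing
      base : ∀ e d → e * d ≡ 1# * e * d
      base = Solver.solve-∀ solverRing
      pull : ∀ t p d → t * p * - d ≡ - 1# * p * (t * d)
      pull = Solver.solve-∀ solverRing
      push : ∀ t p d → - 1# * t * (p * d) ≡ t * p * - d
      push = Solver.solve-∀ solverRing
      drop : ∀ t p d c → - 1# * p * (t * d + c * 0#) ≡ - 1# * t * (p * d)
      drop = Solver.solve-∀ solverRing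

    ι-scaleˡ : ∀ {φ F} c xs → ι (λ x → c * φ x) F xs ≡ c * ι φ F xs
    ι-scaleˡ c [] = nil c
    ι-scaleˡ {φ} {F} c (x ∷ xs) = trans (cong (λ i → c * φ x * F xs - i) (ι-scaleˡ c xs))
      (scale-ring c (φ x) (F xs) _)

    ι-scaleʳ : ∀ {φ F} c xs → ι φ (λ ys → c * F ys) xs ≡ c * ι φ F xs
    ι-scaleʳ c [] = nil c
    ι-scaleʳ {φ} {F} c (x ∷ xs) = trans (cong₂ _-_ (swap c (φ x) (F xs)) (ι-scaleʳ c xs))
      (scale-ring c (φ x) (F xs) _)

    applyUpTo-∈ : ∀ (φ : ℕ → X → Dual) {j n} → j ℕ.< n → Any (_≡ φ j) (applyUpTo φ n)
    applyUpTo-∈ φ {zero}  (s≤s _) = here refl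
    applyUpTo-∈ φ {suc j} (s≤s l) = there (applyUpTo-∈ (φ ∘ suc) l)

    module _ (φ : ℕ → X → Dual) (e : ℕ → Dual) (N : ℕ) where

      difference-column : ℕ → ℕ → X → Dual
      difference-column k j x = Δ k (λ i → e i * φ i x) j

      -- The k-th difference at j + 1 involves only the columns j + 1, ..., j + k + 1, all of which
      -- are already present among the columns 1, ..., N.
      difference-vanishes : ∀ k j → j ℕ.+ k ℕ.< N → ∀ xs →
        ι (difference-column k (suc j)) (det (applyUpTo (φ ∘ suc) N)) xs ≡ 0#
      difference-vanishes zero j l xs = trans (ι-scaleˡ (e (suc j)) xs)
        (trans (cong (e (suc j) *_) (ι-repeat (applyUpTo-∈ (φ ∘ suc) (subst (ℕ._< N) (ℕ.+-identityʳ j) l)) xs))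
               (sym (nil (e (suc j)))))
      difference-vanishes (suc k) j l xs = trans (ι-linearˡ (λ x → sub _ _) xs)
        (cong₂ (λ u v → u + - 1# * v)
          (difference-vanishes k (suc j) (subst (ℕ._< N) (ℕ.+-suc j k) l) xs)
          (difference-vanishes k j (ℕ.≤-<-trans (ℕ.+-monoʳ-≤ j (ℕ.n≤1+n k)) l) xs))

      -- Of the columns 0, ..., k in the difference only column 0 is absent from the determinant,
      -- and its coefficient carries the sign (-1)^k.
      difference-leading : ∀ k → k ℕ.≤ N → ∀ xs →
        ι (difference-column k 0) (det (applyUpTo (φ ∘ suc) N)) xs
        ≡ (- 1#) ^ᵈ k * e 0 * det (applyUpTo φ (suc N)) xs
      difference-leading zero l xs = trans (ι-scaleˡ (e 0) xs) (base (e 0) _)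
      difference-leading (suc k) l xs = trans (ι-linearˡ (λ x → sub _ _) xs)
        (trans (cong₂ (λ u v → u + - 1# * v) (difference-vanishes k 0 l xs) (difference-leading k (ℕ.<⇒≤ l) xs))
               (sign ((- 1#) ^ᵈ k) (e 0) _))

    -- Since ψ is itself a column, multiples of it may be added to the others. The power of t on
    -- both sides stands in for a division by t.
    shift-columns : ∀ {φ χ : ℕ → X → Dual} {ψ} t (c : ℕ → Dual) →
                    (∀ j x → t * χ j x ≡ t * φ j x + c j * ψ x) → ∀ n xs →
                    t ^ᵈ n * ι ψ (det (applyUpTo χ n)) xs ≡ t ^ᵈ n * ι ψ (det (applyUpTo φ n)) xs
    shift-columns t c h zero xs = refl
    shift-columns {φ} {χ} {ψ} t c h (suc n) xs = begin
      t * t ^ᵈ n * ι ψ (ι (χ 0) G) xs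
        -- Exchanging ψ with the first column makes `χ 0` outermost, where linearity applies to it;
        -- in the extra term ψ meets itself.
        ≡⟨ cong (t * t ^ᵈ n *_) (ι-anticomm G xs) ⟩
      t * t ^ᵈ n * - ι (χ 0) (ι ψ G) xs
        ≡⟨ pull t (t ^ᵈ n) _ ⟩
      - 1# * t ^ᵈ n * (t * ι (χ 0) (ι ψ G) xs)
        ≡⟨ cong (- 1# * t ^ᵈ n *_) (ι-scaleˡ t xs) ⟨
      - 1# * t ^ᵈ n * ι (λ x → t * χ 0 x) (ι ψ G) xs
        ≡⟨ cong (- 1# * t ^ᵈ n *_) (ι-linearˡ (h 0) xs) ⟩
      - 1# * t ^ᵈ n * (ι (λ x → t * φ 0 x) (ι ψ G) xs + c 0 * ι ψ (ι ψ G) xs)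
        ≡⟨ cong₂ (λ u v → - 1# * t ^ᵈ n * (u + c 0 * v)) (ι-scaleˡ t xs) (ι-square G xs) ⟩
      - 1# * t ^ᵈ n * (t * ι (φ 0) (ι ψ G) xs + c 0 * 0#)
        ≡⟨ drop t (t ^ᵈ n) _ (c 0) ⟩
      - 1# * t * (t ^ᵈ n * ι (φ 0) (ι ψ G) xs)
        ≡⟨ cong (- 1# * t *_) (ι-scaleʳ (t ^ᵈ n) xs) ⟨
      - 1# * t * ι (φ 0) (λ ys → t ^ᵈ n * ι ψ G ys) xs
        ≡⟨ cong (- 1# * t *_) (ι-cong (λ _ → refl) (shift-columns t (c ∘ suc) (h ∘ suc) n) xs) ⟩
      - 1# * t * ι (φ 0) (λ ys → t ^ᵈ n * ι ψ H ys) xs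
        ≡⟨ cong (- 1# * t *_) (ι-scaleʳ (t ^ᵈ n) xs) ⟩
      - 1# * t * (t ^ᵈ n * ι (φ 0) (ι ψ H) xs)
        ≡⟨ push t (t ^ᵈ n) _ ⟩
      t * t ^ᵈ n * - ι (φ 0) (ι ψ H) xs
        ≡⟨ cong (t * t ^ᵈ n *_) (ι-anticomm H xs) ⟨
      t * t ^ᵈ n * ι ψ (ι (φ 0) H) xs ∎
      where
      G = det (applyUpTo (χ ∘ suc) n)
      H = det (applyUpTo (φ ∘ suc) n)

    ι-real : ∀ {φ F} → (∀ x → Real (φ x)) → (∀ xs → Real (F xs)) → ∀ xs → Real (ι φ F xs)
    ι-real p q []       = real (+ 0)
    ι-real p q (x ∷ xs) = sum-real (product-real (p x) (q xs)) (ι-real p (λ ys → q (x ∷ ys)) xs)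

    det-real : ∀ {φ : ℕ → X → Dual} n → (∀ j x → Real (φ j x)) → ∀ xs → Real (det (applyUpTo φ n) xs)
    det-real zero    p []      = real (+ 1)
    det-real zero    p (_ ∷ _) = real (+ 0)
    det-real (suc n) p         = ι-real (p 0) (det-real n (p ∘ suc))

    -- The N-th difference takes the place of column 0, at the cost of the factor (-1)^N `e 0`, and
    -- is constantly τ. It then serves to turn the other columns into the ε-free χ, after which τ
    -- comes out as a factor and a real determinant with a column of ones is left.
    det-with-constant-combination : ∀ {φ χ : ℕ → X → Dual} {e} N t τ (c : ℕ → Dual) →
      (∀ x → Δ N (λ j → e j * φ j x) 0 ≡ τ) →
      (∀ j x → t * χ j x ≡ t * φ j x + c j * τ) →
      (∀ j x → Real (χ j x)) → ∀ xs →
      ∃ λ δ → Real δ × t ^ᵈ N * ((- 1#) ^ᵈ N * e 0 * det (applyUpTo φ (suc N)) xs) ≡ t ^ᵈ N * (τ * δ)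
    det-with-constant-combination {φ} {χ} {e} N t τ c const shift χ-real xs =
      ι (λ _ → 1#) D xs , ι-real (λ _ → real (+ 1)) (det-real N (χ-real ∘ suc)) xs , (begin
      t ^ᵈ N * ((- 1#) ^ᵈ N * e 0 * det (applyUpTo φ (suc N)) xs)
        ≡⟨ cong (t ^ᵈ N *_) (difference-leading φ e N N ℕ.≤-refl xs) ⟨
      t ^ᵈ N * ι ψ (det (applyUpTo (φ ∘ suc) N)) xs
        ≡⟨ shift-columns t (c ∘ suc) (λ j x → trans (shift (suc j) x) (cong (λ u → t * φ (suc j) x + c (suc j) * u) (sym (const x)))) N xs ⟨
      t ^ᵈ N * ι ψ D xs
        ≡⟨ cong (t ^ᵈ N *_) (ι-cong (λ x → trans (const x) (one τ)) (λ _ → refl) xs) ⟩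
      t ^ᵈ N * ι (λ _ → τ * 1#) D xs
        ≡⟨ cong (t ^ᵈ N *_) (ι-scaleˡ τ xs) ⟩
      t ^ᵈ N * (τ * ι (λ _ → 1#) D xs) ∎)
      where
      ψ : X → Dual
      ψ = difference-column φ e N N 0
      D = det (applyUpTo (χ ∘ suc) N)
      one : ∀ u → u ≡ u * 1#
      one = Solver.solve-∀ solverRing

-- Families of walks, decomposed by their first steps.

module Families where
  open DualNumbers
  import Tactic.RingSolver as Solver
  open import Data.Bool using (Bool; true; false; _∧_; if_then_else_)
  open import Data.Bool.ListAction using (and)
  open import Data.Bool.Properties using (∧-identityʳ; ∧-zeroʳ)
  open import Data.Nat as ℕ using (ℕ; zero; suc; s≤s; z≤n)
  import Data.Nat.Properties as ℕ
  import Data.Nat.Tactic.RingSolver as ℕ-Solver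
  open import Algebra.Properties.CommutativeSemigroup ℕ.+-commutativeSemigroup using (x∙yz≈y∙xz)
  open import Data.Integer as ℤ using (ℤ; +_; 0ℤ; 1ℤ)
  import Data.Integer.Properties as ℤ
  import Data.Integer.Tactic.RingSolver as ℤ-Solver
  open import Data.List using (List; []; _∷_; _++_; map; length; concatMap; filter)
  open import Data.Nat.ListAction using (sum)
  open import Data.Vec as Vec using (Vec; []; _∷_; zipWith; toList)
  open import Data.Product using (∃; _,_)
  open import Data.Sum using (_⊎_; inj₁; inj₂)
  open import Function using (_∘_)
  open import Relation.Nullary using (yes; no; contradiction)
  open import Relation.Nullary.Decidable using (⌊_⌋)
  open import Relation.Binary.PropositionalEquality
  open ≡-Reasoning

  ∑ : {A : Set} → List A → (A → Dual) → Dual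
  ∑ []       G = 0#
  ∑ (x ∷ xs) G = G x + ∑ xs G

  private
    interchange : ∀ a b c d → (a + b) + (c + d) ≡ (a + c) + (b + d)
    interchange = Solver.solve-∀ solverRing
    distrib : ∀ c a b → c * (a + b) ≡ c * a + c * b
    distrib = Solver.solve-∀ solverRing
    scale-nil : ∀ c → 0# ≡ c * 0#
    scale-nil = Solver.solve-∀ solverRing
    +-identityʳ : ∀ x → x + 0# ≡ x
    +-identityʳ = Solver.solve-∀ solverRing

  ∑-cong : {A : Set} {G H : A → Dual} (xs : List A) → (∀ x → G x ≡ H x) → ∑ xs G ≡ ∑ xs H
  ∑-cong []       p = refl
  ∑-cong (x ∷ xs) p = cong₂ _+_ (p x) (∑-cong xs p)

  ∑-scale : {A : Set} {G : A → Dual} (c : Dual) (xs : List A) → ∑ xs (λ x → c * G x) ≡ c * ∑ xs G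
  ∑-scale c []               = scale-nil c
  ∑-scale {G = G} c (x ∷ xs) = trans (cong (λ u → c * G x + u) (∑-scale c xs)) (sym (distrib c (G x) _))

  ∑-+ : {A : Set} {G H : A → Dual} (xs : List A) → ∑ xs (λ x → G x + H x) ≡ ∑ xs G + ∑ xs H
  ∑-+ []                   = refl
  ∑-+ {G = G} {H} (x ∷ xs) = trans (cong (λ u → G x + H x + u) (∑-+ xs)) (interchange (G x) (H x) _ _)

  ∑-++ : {A : Set} {G : A → Dual} (xs ys : List A) → ∑ (xs ++ ys) G ≡ ∑ xs G + ∑ ys G
  ∑-++ []               ys = sym (+-identityˡ _)
  ∑-++ {G = G} (x ∷ xs) ys = trans (cong (λ u → G x + u) (∑-++ xs ys)) (sym (+-assoc (G x) _ _))

  ∑-map : {A B : Set} {G : B → Dual} (f : A → B) (xs : List A) → ∑ (map f xs) G ≡ ∑ xs (G ∘ f)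
  ∑-map f []               = refl
  ∑-map {G = G} f (x ∷ xs) = cong (λ u → G (f x) + u) (∑-map f xs)

  ∑-concatMap : {A B : Set} {G : B → Dual} (f : A → List B) (xs : List A) →
                ∑ (concatMap f xs) G ≡ ∑ xs (λ x → ∑ (f x) G)
  ∑-concatMap f []               = refl
  ∑-concatMap {G = G} f (x ∷ xs) = trans (∑-++ (f x) (concatMap f xs)) (cong (λ u → ∑ (f x) G + u) (∑-concatMap f xs))

  ∑-zero : {A : Set} {G : A → Dual} (xs : List A) → (∀ x → G x ≡ 0#) → ∑ xs G ≡ 0#
  ∑-zero []       p = refl
  ∑-zero (x ∷ xs) p = cong₂ _+_ (p x) (∑-zero xs p)

  ∑steps : ∀ n → (Vec Step n → Dual) → Dual
  ∑steps zero    H = H []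
  ∑steps (suc n) H = ∑steps n (λ σ → H (true ∷ σ)) + ∑steps n (λ σ → H (false ∷ σ))

  ∑steps-cong : ∀ n {G H : Vec Step n → Dual} → (∀ σ → G σ ≡ H σ) → ∑steps n G ≡ ∑steps n H
  ∑steps-cong zero    p = p []
  ∑steps-cong (suc n) p = cong₂ _+_ (∑steps-cong n (λ σ → p (true ∷ σ))) (∑steps-cong n (λ σ → p (false ∷ σ)))

  ∑steps-scale : ∀ n (c : Dual) (G : Vec Step n → Dual) → ∑steps n (λ σ → c * G σ) ≡ c * ∑steps n G
  ∑steps-scale zero    c G = refl
  ∑steps-scale (suc n) c G = trans (cong₂ _+_ (∑steps-scale n c _) (∑steps-scale n c _)) (sym (distrib c _ _))

  ∑steps-+ : ∀ n {G H : Vec Step n → Dual} → ∑steps n (λ σ → G σ + H σ) ≡ ∑steps n G + ∑steps n H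
  ∑steps-+ zero    = refl
  ∑steps-+ (suc n) = trans (cong₂ _+_ (∑steps-+ n) (∑steps-+ n)) (interchange (∑steps n _) _ _ _)

  prepend : ∀ {n t} → Vec Step n → Vec (Vec Step t) n → Vec (Vec Step (suc t)) n
  prepend = zipWith _∷_

  -- `allFamilies` enumerates walk by walk, whereas the recurrence in t removes the first step of
  -- all walks simultaneously; this is the reordering of the sum between the two.
  ∑-allFamilies-suc : ∀ n t (G : Vec (Vec Step (suc t)) n → Dual) →
    ∑ (allFamilies n (suc t)) G ≡ ∑steps n (λ σ → ∑ (allFamilies n t) (λ f → G (prepend σ f)))
  ∑-allFamilies-suc zero    t G = refl
  ∑-allFamilies-suc (suc n) t G = begin
    ∑ (concatMap (λ f → map (_∷ f) (allSteps (suc t))) (allFamilies n (suc t))) G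
      ≡⟨ ∑-concatMap _ (allFamilies n (suc t)) ⟩
    ∑ (allFamilies n (suc t)) (λ f → ∑ (map (_∷ f) (allSteps (suc t))) G)
      ≡⟨ ∑-cong (allFamilies n (suc t)) (λ f → trans (∑-map (_∷ f) (allSteps (suc t))) (trans (∑-concatMap _ (allSteps t))
           (trans (∑-cong (allSteps t) (λ s → cong (λ u → G ((true ∷ s) ∷ f) + u) (+-identityʳ _))) (∑-+ (allSteps t))))) ⟩
    ∑ (allFamilies n (suc t)) (λ f → K true f + K false f)
      ≡⟨ ∑-allFamilies-suc n t _ ⟩
    ∑steps n (λ σ → ∑ (allFamilies n t) (λ f → K true (prepend σ f) + K false (prepend σ f)))
      ≡⟨ ∑steps-cong n (λ σ → ∑-+ (allFamilies n t)) ⟩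
    ∑steps n (λ σ → ∑ (allFamilies n t) (K true ∘ prepend σ) + ∑ (allFamilies n t) (K false ∘ prepend σ))
      ≡⟨ ∑steps-+ n ⟩
    ∑steps n (λ σ → ∑ (allFamilies n t) (K true ∘ prepend σ)) + ∑steps n (λ σ → ∑ (allFamilies n t) (K false ∘ prepend σ))
      ≡⟨ cong₂ _+_ (∑steps-cong n (collect true)) (∑steps-cong n (collect false)) ⟩
    ∑steps n (λ σ → ∑ (allFamilies (suc n) t) (λ f → G (prepend (true ∷ σ) f))) +
    ∑steps n (λ σ → ∑ (allFamilies (suc n) t) (λ f → G (prepend (false ∷ σ) f))) ∎
    where
    K : Step → Vec (Vec Step (suc t)) n → Dual
    K b f = ∑ (allSteps t) (λ s → G ((b ∷ s) ∷ f))
    collect : ∀ b σ → ∑ (allFamilies n t) (K b ∘ prepend σ)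
              ≡ ∑ (allFamilies (suc n) t) (λ f → G (prepend (b ∷ σ) f))
    collect b σ = sym (trans (∑-concatMap _ (allFamilies n t))
      (∑-cong (allFamilies n t) (λ f → ∑-map (_∷ f) (allSteps t))))

  stay : ∀ n → Vec (Vec Step 0) n
  stay n = Vec.replicate n []

  ∑-allFamilies-zero : ∀ n (G : Vec (Vec Step 0) n → Dual) → ∑ (allFamilies n 0) G ≡ G (stay n)
  ∑-allFamilies-zero zero    G = +-identityʳ _
  ∑-allFamilies-zero (suc n) G = trans (∑-concatMap _ (allFamilies n 0))
    (trans (∑-cong (allFamilies n 0) (λ f → +-identityʳ _)) (∑-allFamilies-zero n _))

  shift : ℤ → Step → ℤ
  shift h true  = h ℤ.+ 1ℤ
  shift h false = h ℤ.- 1ℤ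

  move : ∀ {n} → Vec ℤ n → Vec Step n → Vec ℤ n
  move = zipWith shift

  paths : ∀ {n t} → Vec ℤ n → Vec (Vec Step t) n → List (List ℤ)
  paths []       []      = []
  paths (x ∷ xs) (s ∷ f) = heights x s ∷ paths xs f

  -- The start heights are arbitrary, because removing a step moves them, while the end heights
  -- remain 0, 2, 4, ....
  vicious : ∀ {n t} → Vec ℤ n → Vec (Vec Step t) n → Bool
  vicious xs f = validWalks 0 0 (paths xs f) ∧ pairwiseDisjoint (paths xs f)

  visits : List ℤ → ℕ
  visits hs = length (filter (λ h → h ℤ.≟ 0ℤ) hs)

  touches : ∀ {n t} → Vec ℤ n → Vec (Vec Step t) n → ℕ
  touches xs f = sum (map visits (paths xs f))

  allNonneg : ∀ {n} → Vec ℤ n → Bool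
  allNonneg []       = true
  allNonneg (x ∷ xs) = ⌊ 0ℤ ℤ.≤? x ⌋ ∧ allNonneg xs

  differ : ∀ {n} → ℤ → Vec ℤ n → Bool
  differ x []       = true
  differ x (y ∷ ys) = (if ⌊ x ℤ.≟ y ⌋ then false else true) ∧ differ x ys

  distinct : ∀ {n} → Vec ℤ n → Bool
  distinct []       = true
  distinct (x ∷ xs) = differ x xs ∧ distinct xs

  heights-∷ : ∀ {t} x b (s : Vec Step t) → heights x (b ∷ s) ≡ x ∷ heights (shift x b) s
  heights-∷ x true  s = refl
  heights-∷ x false s = refl

  last-heights : ∀ {t} d x y (s : Vec Step t) → last d (x ∷ heights y s) ≡ last d (heights y s)
  last-heights d x y []          = refl
  last-heights d x y (true ∷ s)  = refl
  last-heights d x y (false ∷ s) = refl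

  private
    ∧-shuffle : ∀ p n l q v → (p ∧ n) ∧ (l ∧ (q ∧ v)) ≡ (p ∧ q) ∧ (n ∧ (l ∧ v))
    ∧-shuffle false n l q v             = refl
    ∧-shuffle true n l true v           = refl
    ∧-shuffle true false l false v      = refl
    ∧-shuffle true true false false v   = refl
    ∧-shuffle true true true false v    = refl

    ∧-interchange : ∀ p q r s → (p ∧ q) ∧ (r ∧ s) ≡ (p ∧ r) ∧ (q ∧ s)
    ∧-interchange false q r s          = refl
    ∧-interchange true true r s        = refl
    ∧-interchange true false true s    = refl
    ∧-interchange true false false s   = refl

  validWalks-prepend : ∀ {n t} k xs σ (f : Vec (Vec Step t) n) →
    validWalks 0 k (paths xs (prepend σ f)) ≡ allNonneg xs ∧ validWalks 0 k (paths (move xs σ) f)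
  validWalks-prepend k []       []      []      = refl
  validWalks-prepend k (x ∷ xs) (b ∷ σ) (s ∷ f)
    rewrite heights-∷ x b s | last-heights 0ℤ x (shift x b) s | validWalks-prepend (suc k) xs σ f
    = ∧-shuffle ⌊ 0ℤ ℤ.≤? x ⌋ (nonneg (heights (shift x b) s))
        ⌊ last 0ℤ (heights (shift x b) s) ℤ.≟ + (2 ℕ.* k) ⌋ (allNonneg xs) _

  disjoint-prepend : ∀ {n t} x hs xs σ (f : Vec (Vec Step t) n) →
    and (map (disjoint (x ∷ hs)) (paths xs (prepend σ f))) ≡ differ x xs ∧ and (map (disjoint hs) (paths (move xs σ) f))
  disjoint-prepend x hs []       []      []      = refl
  disjoint-prepend x hs (y ∷ xs) (b ∷ σ) (s ∷ f)
    rewrite heights-∷ y b s | disjoint-prepend x hs xs σ f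
    = ∧-interchange (if ⌊ x ℤ.≟ y ⌋ then false else true) (disjoint hs (heights (shift y b) s)) _ _

  pairwiseDisjoint-prepend : ∀ {n t} xs σ (f : Vec (Vec Step t) n) →
    pairwiseDisjoint (paths xs (prepend σ f)) ≡ distinct xs ∧ pairwiseDisjoint (paths (move xs σ) f)
  pairwiseDisjoint-prepend []       []      []      = refl
  pairwiseDisjoint-prepend (x ∷ xs) (b ∷ σ) (s ∷ f)
    rewrite heights-∷ x b s | disjoint-prepend x (heights (shift x b) s) xs σ f | pairwiseDisjoint-prepend xs σ f
    = ∧-interchange (differ x xs) _ (distinct xs) _

  -- Nonnegativity and disjointness are conjunctions over the x-coordinates, so their part at the
  -- first one separates; the end condition is unaffected by a removed step.
  vicious-prepend : ∀ {n t} xs σ (f : Vec (Vec Step t) n) →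
    vicious xs (prepend σ f) ≡ (allNonneg xs ∧ distinct xs) ∧ vicious (move xs σ) f
  vicious-prepend xs σ f rewrite validWalks-prepend 0 xs σ f | pairwiseDisjoint-prepend xs σ f
    = ∧-interchange (allNonneg xs) _ (distinct xs) _

  zeros : ∀ {n} → Vec ℤ n → ℕ
  zeros xs = visits (toList xs)

  touches-prepend : ∀ {n t} xs σ (f : Vec (Vec Step t) n) →
    touches xs (prepend σ f) ≡ zeros xs ℕ.+ touches (move xs σ) f
  touches-prepend []       []      []      = refl
  touches-prepend (x ∷ xs) (b ∷ σ) (s ∷ f) rewrite heights-∷ x b s | touches-prepend xs σ f
    with x ℤ.≟ 0ℤ
  ... | yes _ = cong suc (x∙yz≈y∙xz (visits (heights (shift x b) s)) (zeros xs) _)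
  ... | no _  = x∙yz≈y∙xz (visits (heights (shift x b) s)) (zeros xs) _

  -- Consecutive gaps are even, so that walks cannot cross without meeting, and at least 2m.
  data Chain (m : ℕ) : ∀ {n} → Vec ℤ n → Set where
    []  : Chain m []
    [-] : ∀ {x} → Chain m (x ∷ [])
    _∷_ : ∀ {n x y} {ys : Vec ℤ n} → (∃ λ d → y ≡ x ℤ.+ + 2 ℤ.* + (m ℕ.+ d)) → Chain m (y ∷ ys) → Chain m (x ∷ y ∷ ys)

  data Collision : ∀ {n} → Vec ℤ n → Set where
    here  : ∀ {n x} {xs : Vec ℤ n} → Collision (x ∷ x ∷ xs)
    there : ∀ {n x} {xs : Vec ℤ n} → Collision xs → Collision (x ∷ xs)

  -- This dichotomy takes the place of the sign-reversing involution: at a collision both the count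
  -- and the determinant vanish, and otherwise the recurrence in t advances.
  split : ∀ {n} {xs : Vec ℤ n} → Chain 0 xs → Chain 1 xs ⊎ Collision xs
  split []  = inj₁ []
  split [-] = inj₁ [-]
  split {xs = x ∷ _} ((zero , refl) ∷ ch) rewrite ℤ.+-identityʳ x = inj₂ here
  split ((suc d , p) ∷ ch) with split ch
  ... | inj₁ st = inj₁ ((d , p) ∷ st)
  ... | inj₂ co = inj₂ (there co)

  private
    same : ∀ e x d → (x ℤ.+ + 2 ℤ.* d) ℤ.+ e ≡ (x ℤ.+ e) ℤ.+ + 2 ℤ.* d
    same = ℤ-Solver.solve-∀
    closer : ∀ x d → (x ℤ.+ + 2 ℤ.* (+ 1 ℤ.+ d)) ℤ.- + 1 ≡ (x ℤ.+ + 1) ℤ.+ + 2 ℤ.* d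
    closer = ℤ-Solver.solve-∀
    further : ∀ x d → (x ℤ.+ + 2 ℤ.* d) ℤ.+ + 1 ≡ (x ℤ.- + 1) ℤ.+ + 2 ℤ.* (+ 1 ℤ.+ d)
    further = ℤ-Solver.solve-∀

  shift-gap : ∀ x d b c → ∃ λ e → shift (x ℤ.+ + 2 ℤ.* + suc d) c ≡ shift x b ℤ.+ + 2 ℤ.* + e
  shift-gap x d true  true  = suc d , same (+ 1) x (+ suc d)
  shift-gap x d true  false = d , closer x (+ d)
  shift-gap x d false true  = suc (suc d) , further x (+ suc d)
  shift-gap x d false false = suc d , same (ℤ.- + 1) x (+ suc d)

  -- One step changes a gap by at most 2, so a gap of at least 2 stays nonnegative.
  move-chain : ∀ {n} {xs : Vec ℤ n} → Chain 1 xs → ∀ σ → Chain 0 (move xs σ)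
  move-chain [] [] = []
  move-chain [-] (b ∷ []) = [-]
  move-chain {xs = x ∷ _} ((d , refl) ∷ st) (b ∷ c ∷ σ) = shift-gap x d b c ∷ move-chain st (c ∷ σ)

  heights-head : ∀ {t} x (s : Vec Step t) → ∃ λ hs → heights x s ≡ x ∷ hs
  heights-head x []          = _ , refl
  heights-head x (true ∷ s)  = _ , refl
  heights-head x (false ∷ s) = _ , refl

  x≟x : ∀ x → ⌊ x ℤ.≟ x ⌋ ≡ true
  x≟x x with x ℤ.≟ x
  ... | yes _  = refl
  ... | no x≢x = contradiction refl x≢x

  collision⇒¬disjoint : ∀ {n t} {xs : Vec ℤ n} → Collision xs → (f : Vec (Vec Step t) n) →
                        pairwiseDisjoint (paths xs f) ≡ false
  collision⇒¬disjoint {xs = x ∷ x ∷ xs} here (s ∷ s′ ∷ f)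
    with heights x s | heights-head x s | heights x s′ | heights-head x s′
  ... | _ | _ , refl | _ | _ , refl rewrite x≟x x = refl
  collision⇒¬disjoint (there co) (s ∷ f) rewrite collision⇒¬disjoint co f = ∧-zeroʳ _

  gap-< : ∀ x d → x ℤ.< x ℤ.+ + 2 ℤ.* + suc d
  gap-< x d = subst (ℤ._< x ℤ.+ + (2 ℕ.* suc d)) (ℤ.+-identityʳ x) (ℤ.+-monoʳ-< x (ℤ.+<+ (s≤s z≤n)))

  differ-below : ∀ {n x} {ys : Vec ℤ n} z → Chain 1 (x ∷ ys) → z ℤ.< x → differ z (x ∷ ys) ≡ true
  differ-below {x = x} z ch z<x with z ℤ.≟ x
  ... | yes refl = contradiction z<x (ℤ.<-irrefl refl)
  differ-below z [-] z<x | no _ = refl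
  differ-below {x = x} z ((d , refl) ∷ ch) z<x | no _ = differ-below z ch
    (ℤ.<-trans z<x (gap-< x d))

  strict⇒distinct : ∀ {n} {xs : Vec ℤ n} → Chain 1 xs → distinct xs ≡ true
  strict⇒distinct []  = refl
  strict⇒distinct [-] = refl
  strict⇒distinct {xs = x ∷ _} ((d , refl) ∷ ch)
    rewrite differ-below x ch (gap-< x d) = strict⇒distinct ch

  weaken : ∀ {n} {xs : Vec ℤ n} → Chain 1 xs → Chain 0 xs
  weaken []               = []
  weaken [-]              = [-]
  weaken ((d , p) ∷ ch) = (suc d , p) ∷ weaken ch

  start : ℕ → (n : ℕ) → Vec ℤ n
  start k zero    = []
  start k (suc n) = + (2 ℕ.* k) ∷ start (suc k) n

  private
    2[1+k]+ : ∀ k d → 2 ℕ.* k ℕ.+ 2 ℕ.* suc d ≡ 2 ℕ.* suc k ℕ.+ 2 ℕ.* d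
    2[1+k]+ = ℕ-Solver.solve-∀

  -- The lowest of the remaining walks should be at height 2k; d is its excess, of either parity.
  data Floor (k : ℕ) : ∀ {n} → Vec ℤ n → Set where
    []    : Floor k []
    above : ∀ {n x} {xs : Vec ℤ n} d → x ≡ + (2 ℕ.* k ℕ.+ d) → Floor k (x ∷ xs)

  tail-chain : ∀ {m n x} {xs : Vec ℤ n} → Chain m (x ∷ xs) → Chain m xs
  tail-chain [-]      = []
  tail-chain (_ ∷ ch) = ch

  tail-floor : ∀ k {n} {xs : Vec ℤ n} → Chain 1 (+ (2 ℕ.* k) ∷ xs) → Floor (suc k) xs
  tail-floor k [-]              = []
  tail-floor k ((e , refl) ∷ _) = above (2 ℕ.* e) (cong +_ (2[1+k]+ k e))

  valid-start : ∀ k n → validWalks 0 k (paths (start k n) (stay n)) ≡ true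
  valid-start k zero = refl
  valid-start k (suc n) rewrite x≟x (+ (2 ℕ.* k)) = valid-start (suc k) n

  pairwiseDisjoint-stay : ∀ {n} (xs : Vec ℤ n) → pairwiseDisjoint (paths xs (stay n)) ≡ distinct xs
  pairwiseDisjoint-stay []       = refl
  pairwiseDisjoint-stay (x ∷ xs) = cong₂ _∧_ (differs x xs) (pairwiseDisjoint-stay xs)
    where
    differs : ∀ x {n} (ys : Vec ℤ n) → and (map (disjoint (x ∷ [])) (paths ys (stay n))) ≡ differ x ys
    differs x []       = refl
    differs x (y ∷ ys) = cong₂ _∧_ (∧-identityʳ _) (differs x ys)

  touches-start : ∀ k n → touches (start (suc k) n) (stay n) ≡ 0
  touches-start k zero    = refl
  touches-start k (suc n) = touches-start (suc k) n

  packed-strict : ∀ k n → Chain 1 (start k n)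
  packed-strict k zero          = []
  packed-strict k (suc zero)    = [-]
  packed-strict k (suc (suc n)) = (0 , cong +_ (trans (ℕ.*-suc 2 k) (ℕ.+-comm 2 (2 ℕ.* k)))) ∷ packed-strict (suc k) (suc n)

-- The determinant for weighted vicious walks.

module WeightedWalks where
  open DualNumbers
  open Determinants
  open Families
  import Tactic.RingSolver as Solver
  open import Data.Bool using (true; false; _∧_; if_then_else_)
  open import Data.Bool.Properties using (∧-identityʳ; ∧-zeroʳ)
  open import Data.Nat as ℕ using (ℕ; zero; suc)
  import Data.Nat.Properties as ℕ
  import Data.Nat.Tactic.RingSolver as ℕ-Solver
  open import Data.Integer as ℤ using (ℤ; +_; -[1+_]; 1ℤ; +[1+_])
  import Data.Integer.Properties as ℤ
  open import Data.List using (List; []; _∷_; map; applyUpTo)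
  open import Data.List.Relation.Unary.All using (All; []; _∷_)
  open import Data.List.Relation.Unary.All.Properties using (applyUpTo⁺₂)
  open import Data.Vec as Vec using (Vec; []; _∷_; toList)
  open import Data.Product using (_×_; _,_)
  open import Data.Sum using (_⊎_; inj₁; inj₂)
  open import Function using (_∘_)
  open import Relation.Nullary using (yes; no; contradiction)
  open import Relation.Nullary.Decidable using (⌊_⌋)
  open import Relation.Binary.PropositionalEquality
  open ≡-Reasoning

  private
    distrib : ∀ c a b → c * (a + b) ≡ c * a + c * b
    distrib = Solver.solve-∀ solverRing
    zero-scale : ∀ u → 0# * u ≡ 0#
    zero-scale = Solver.solve-∀ solverRing

  module Weighted (κ : Dual) where
    open Contraction {ℕ → Dual}

    -- The value 0 below the axis encodes the wall, so that the recurrences need no side condition.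
    weight : ℤ → Dual
    weight (+ zero)  = κ
    weight +[1+ _ ]  = 1#
    weight -[1+ _ ]  = 0#

    weights : ∀ {n} → Vec ℤ n → Dual
    weights []       = 1#
    weights (x ∷ xs) = weight x * weights xs

    -- Total weight of the walks of length m from height x to height 0, both ends being contacts.
    toAxis : ℕ → ℤ → Dual
    toAxis zero    (+ zero) = κ
    toAxis zero    _        = 0#
    toAxis (suc m) x        = weight x * (toAxis m (x ℤ.+ 1ℤ) + toAxis m (x ℤ.- 1ℤ))

    -- A walk ending at (t , 2j) is prolonged straight down to the axis.
    row : ℕ → ℤ → ℕ → Dual
    row t x j = toAxis (t ℕ.+ 2 ℕ.* j) x

    entry : ℕ → (ℕ → Dual) → Dual
    entry j x = x j

    -- The selection c of columns is general because the evaluation at t = 0 strips off leading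
    -- columns one by one.
    rowDet : (ℕ → ℕ) → ℕ → List (ℕ → Dual) → Dual
    rowDet c n = det (applyUpTo (entry ∘ c) n)

    value : ∀ {n t} → Vec ℤ n → Vec (Vec Step t) n → Dual
    value xs f = if vicious xs f then κ ^ᵈ touches xs f else 0#

    private
      factor : ∀ w a b s → w * (s * a) + w * (s * b) ≡ (w * s) * (a + b)
      factor = Solver.solve-∀ solverRing

    pow-+ : ∀ x a b → x ^ᵈ (a ℕ.+ b) ≡ x ^ᵈ a * x ^ᵈ b
    pow-+ x zero    b = sym (*-identityˡ _)
    pow-+ x (suc a) b = trans (cong (x *_) (pow-+ x a b)) (sym (*-assoc x _ _))

    weights-nonneg : ∀ {n} (xs : Vec ℤ n) → weights xs ≡ (if allNonneg xs then κ ^ᵈ zeros xs else 0#)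
    weights-nonneg []                  = refl
    weights-nonneg (+ zero ∷ xs)  rewrite weights-nonneg xs with allNonneg xs
    ... | true  = refl
    ... | false = trans (*-comm κ 0#) (zero-scale κ)
    weights-nonneg (+[1+ n ] ∷ xs) rewrite weights-nonneg xs = *-identityˡ _
    weights-nonneg (-[1+ n ] ∷ xs) = zero-scale _

    value-prepend : ∀ {n t} xs → distinct xs ≡ true → ∀ σ (f : Vec (Vec Step t) n) →
                    value xs (prepend σ f) ≡ weights xs * value (move xs σ) f
    value-prepend xs p σ f
      rewrite vicious-prepend xs σ f | p | ∧-identityʳ (allNonneg xs) | touches-prepend xs σ f | weights-nonneg xs
      with allNonneg xs | vicious (move xs σ) f
    ... | false | _     = sym (zero-scale _)
    ... | true  | true  = pow-+ κ (zeros xs) _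
    ... | true  | false = sym (trans (*-comm (κ ^ᵈ zeros xs) 0#) (zero-scale _))

    -- Each row is expanded by its one-step recurrence, and multilinearity yields one term for every
    -- choice σ of first steps. Rows already expanded are absorbed into F.
    rows-step : ∀ {t F} → (∀ x → SplitsAt (weight x) (weight x) (row t (x ℤ.+ 1ℤ)) (row t (x ℤ.- 1ℤ)) (row (suc t) x) F) →
                ∀ {n} (xs : Vec ℤ n) →
                F (map (row (suc t)) (toList xs)) ≡ weights xs * ∑steps n (λ σ → F (map (row t) (toList (move xs σ))))
    rows-step s [] = sym (*-identityˡ _)
    rows-step {t} {F} s (x ∷ xs) = begin
      F (row (suc t) x ∷ map (row (suc t)) (toList xs))
        ≡⟨ s x [] _ ⟩
      w * F (row t (x ℤ.+ 1ℤ) ∷ map (row (suc t)) (toList xs)) + w * F (row t (x ℤ.- 1ℤ) ∷ map (row (suc t)) (toList xs))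
        ≡⟨ cong₂ (λ u v → w * u + w * v)
             (rows-step {t} {λ ys → F (row t (x ℤ.+ 1ℤ) ∷ ys)} (λ y p → s y (row t (x ℤ.+ 1ℤ) ∷ p)) xs)
             (rows-step {t} {λ ys → F (row t (x ℤ.- 1ℤ) ∷ ys)} (λ y p → s y (row t (x ℤ.- 1ℤ) ∷ p)) xs) ⟩
      w * (weights xs * _) + w * (weights xs * _)
        ≡⟨ factor w _ _ (weights xs) ⟩
      (w * weights xs) * _ ∎
      where w = weight x

    rowDet-step : ∀ t c m {n} (xs : Vec ℤ n) →
      rowDet c m (map (row (suc t)) (toList xs)) ≡ weights xs * ∑steps n (λ σ → rowDet c m (map (row t) (toList (move xs σ))))
    rowDet-step t c m = rows-step {t} {rowDet c m}
      (λ x → det-splits (applyUpTo⁺₂ (entry ∘ c) m (λ j → distrib (weight x) _ _)))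

    collision⇒det-zero : ∀ f F {n} {xs : Vec ℤ n} → Alternating F → Collision xs → F (map f (toList xs)) ≡ 0#
    collision⇒det-zero f F alt here = alt [] _ _
    collision⇒det-zero f F {xs = x ∷ _} alt (there co) =
      collision⇒det-zero f (λ ys → F (f x ∷ ys)) (λ p → alt (f x ∷ p)) co

    private
      one-zero : 1# * (0# + 0#) ≡ 0#
      one-zero = refl
      one-right : ∀ u → 1# * (0# + u) ≡ u
      one-right = Solver.solve-∀ solverRing
      leading : ∀ u → κ * u - 0# ≡ κ * u
      leading u = lemma κ u
        where
        lemma : ∀ c u → c * u - 0# ≡ c * u
        lemma = Solver.solve-∀ solverRing
      up : ∀ m d → suc (m ℕ.+ suc d) ℕ.+ 1 ≡ m ℕ.+ suc (suc (suc d))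
      up = ℕ-Solver.solve-∀
      up₁ : ∀ m → suc m ℕ.+ 1 ≡ m ℕ.+ 2
      up₁ = ℕ-Solver.solve-∀
      gap : ∀ k d e → 2 ℕ.* k ℕ.+ suc d ℕ.+ 2 ℕ.* suc e ≡ 2 ℕ.* k ℕ.+ suc (d ℕ.+ 2 ℕ.* suc e)
      gap = ℕ-Solver.solve-∀

    toAxis-negative : ∀ m n → toAxis m -[1+ n ] ≡ 0#
    toAxis-negative zero    n = refl
    toAxis-negative (suc m) n = zero-scale _

    toAxis-far : ∀ m d → toAxis m (+ (m ℕ.+ suc d)) ≡ 0#
    toAxis-far zero    d = refl
    toAxis-far (suc m) d = trans
      (cong₂ (λ u v → 1# * (u + v)) (trans (cong (toAxis m ∘ +_) (up m d)) (toAxis-far m (suc (suc d)))) (toAxis-far m d))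
      one-zero

    toAxis-diagonal : ∀ m → toAxis m (+ m) ≡ κ
    toAxis-diagonal zero    = refl
    toAxis-diagonal (suc m) = trans
      (cong₂ (λ u v → 1# * (u + v)) (trans (cong (toAxis m ∘ +_) (up₁ m)) (toAxis-far m 1)) (toAxis-diagonal m))
      (one-right κ)

    far-entries : ∀ k d {n} {xs : Vec ℤ n} → Chain 1 (+ (2 ℕ.* k ℕ.+ suc d) ∷ xs) →
                  All (λ x → x k ≡ 0#) (map (row 0) (toList (+ (2 ℕ.* k ℕ.+ suc d) ∷ xs)))
    far-entries k d [-] = toAxis-far (2 ℕ.* k) d ∷ []
    far-entries k d ((e , refl) ∷ ch) = toAxis-far (2 ℕ.* k) d ∷ lemma (gap k d e) ch
      where
      lemma : ∀ {n y} {ys : Vec ℤ n} → y ≡ 2 ℕ.* k ℕ.+ suc (d ℕ.+ 2 ℕ.* suc e) → Chain 1 (+ y ∷ ys) →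
              All (λ x → x k ≡ 0#) (map (row 0) (toList (+ y ∷ ys)))
      lemma refl ch = far-entries k (d ℕ.+ 2 ℕ.* suc e) ch

    private
      c0≡k : ∀ {k} {c : ℕ → ℕ} → (∀ j → c j ≡ k ℕ.+ j) → c 0 ≡ k
      c0≡k {k} h = trans (h 0) (ℕ.+-identityʳ k)

    expand : ∀ {k} n c → (∀ j → c j ≡ k ℕ.+ j) → ∀ {xs} → All (λ x → x k ≡ 0#) xs →
             rowDet c (suc n) (row 0 (+ (2 ℕ.* k)) ∷ xs) ≡ κ * rowDet (c ∘ suc) n xs
    expand {k} n c h {xs} v = trans
      (cong₂ (λ u i → u * rowDet (c ∘ suc) n xs - i)
        (trans (cong (λ j → toAxis (2 ℕ.* j) (+ (2 ℕ.* k))) (c0≡k h)) (toAxis-diagonal (2 ℕ.* k)))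
        (ι-zeroˡ xs (subst (λ i → All (λ x → x i ≡ 0#) xs) (sym (c0≡k h)) v)))
      (leading _)

    tail-far : ∀ k {n} {xs : Vec ℤ n} → Chain 1 (+ (2 ℕ.* k) ∷ xs) → All (λ x → x k ≡ 0#) (map (row 0) (toList xs))
    tail-far k [-]               = []
    tail-far k ((e , refl) ∷ ch) = far-entries k (e ℕ.+ suc (e ℕ.+ 0)) ch

    -- At t = 0 the matrix for the packed heights is triangular with diagonal κ. From a height above
    -- 2k the axis cannot be reached in 2k steps. So either the lowest height is exactly 2k and
    -- column k reduces to its top entry, or column k vanishes and the family misses its endpoints.
    initial : ∀ k c → (∀ j → c j ≡ k ℕ.+ j) → ∀ {n} (xs : Vec ℤ n) → Chain 1 xs → Floor k xs →
      (xs ≡ start k n × rowDet c n (map (row 0) (toList xs)) ≡ κ ^ᵈ n) ⊎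
      (validWalks 0 k (paths xs (stay n)) ≡ false × rowDet c n (map (row 0) (toList xs)) ≡ 0#)
    initial k c h [] ch fl = inj₁ (refl , refl)
    initial k c h (x ∷ xs) ch (above (suc d) refl) = inj₂
      ( cong (_∧ validWalks 0 (suc k) (paths xs (stay _))) ≢2k
      , ι-zeroˡ {F = det (applyUpTo (entry ∘ c ∘ suc) (Vec.length xs))} (map (row 0) (toList (x ∷ xs))) (subst (λ i → All (λ x → x i ≡ 0#) (map (row 0) (toList (x ∷ xs)))) (sym (c0≡k h)) (far-entries k d ch)))
      where
      ≢2k : ⌊ + (2 ℕ.* k ℕ.+ suc d) ℤ.≟ + (2 ℕ.* k) ⌋ ≡ false
      ≢2k with + (2 ℕ.* k ℕ.+ suc d) ℤ.≟ + (2 ℕ.* k)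
      ... | yes p = contradiction (ℤ.+-injective p) (ℕ.m+1+n≢m (2 ℕ.* k))
      ... | no _  = refl
    initial k c h (x ∷ xs) ch (above zero p) with trans p (cong +_ (ℕ.+-identityʳ (2 ℕ.* k)))
    ... | refl with initial (suc k) (c ∘ suc) (λ j → trans (h (suc j)) (ℕ.+-suc k j)) xs (tail-chain ch) (tail-floor k ch)
    ...   | inj₁ (refl , q) = inj₁ (refl , trans (expand (Vec.length xs) c h (tail-far k ch)) (cong (κ *_) q))
    ...   | inj₂ (v , q)    = inj₂
      ( trans (cong (⌊ + (2 ℕ.* k) ℤ.≟ + (2 ℕ.* k) ⌋ ∧_) v) (∧-zeroʳ _)
      , trans (expand (Vec.length xs) c h (tail-far k ch)) (trans (cong (κ *_) q) (trans (*-comm κ 0#) (zero-scale κ))))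

    private
      pow-comm : ∀ p → p * (κ * 1#) ≡ κ * p
      pow-comm p = lemma κ p
        where
        lemma : ∀ c p → p * (c * 1#) ≡ c * p
        lemma = Solver.solve-∀ solverRing
      zeroʳ : ∀ p → p * 0# ≡ 0#
      zeroʳ = Solver.solve-∀ solverRing
      rearrange : ∀ p w s → p * (w * s) ≡ w * (p * s)
      rearrange = Solver.solve-∀ solverRing

    -- In the one configuration that counts, only the lowest walk has a contact, whereas the
    -- determinant is κ^(N + 1): each of the N upper walks gains a contact at the end of its
    -- prolongation. If the lowest height is negative, both sides are 0.
    value-initial : ∀ N (xs : Vec ℤ (suc N)) → Chain 1 xs →
                    κ ^ᵈ N * value xs (stay (suc N)) ≡ rowDet (λ j → j) (suc N) (map (row 0) (toList xs))
    value-initial N (-[1+ m ] ∷ xs) ch = trans (zeroʳ _)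
      (sym (det-zero-row {φs = applyUpTo entry (suc N)} (applyUpTo⁺₂ entry (suc N) (λ j → toAxis-negative (2 ℕ.* j) m)) _))
    value-initial N (+ m ∷ xs) ch with initial 0 (λ j → j) (λ _ → refl) (+ m ∷ xs) ch (above m refl)
    ... | inj₂ (v , q) rewrite v = trans (zeroʳ _) (sym q)
    ... | inj₁ (refl , q) rewrite valid-start 1 N | pairwiseDisjoint-stay (start 0 (suc N)) | strict⇒distinct ch
                          | touches-start 0 N = trans (pow-comm _) (sym q)

    value-collision : ∀ {n t} {xs : Vec ℤ n} → Collision xs → (f : Vec (Vec Step t) n) → value xs f ≡ 0#
    value-collision {xs = xs} co f rewrite collision⇒¬disjoint co f | ∧-zeroʳ (validWalks 0 0 (paths xs f)) = refl

    -- Lindström–Gessel–Viennot, with both sides satisfying the same recurrence in t.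
    weighted-count : ∀ N t (xs : Vec ℤ (suc N)) → Chain 0 xs →
      κ ^ᵈ N * ∑ (allFamilies (suc N) t) (value xs) ≡ rowDet (λ j → j) (suc N) (map (row t) (toList xs))
    weighted-count N t xs ch with split ch
    ... | inj₂ co = trans (cong (κ ^ᵈ N *_) (∑-zero (allFamilies (suc N) t) (value-collision co)))
      (trans (zeroʳ _) (sym (collision⇒det-zero (row t) (rowDet (λ j → j) (suc N)) (det-alternating (applyUpTo entry (suc N))) co)))
    weighted-count N zero xs ch | inj₁ st =
      trans (cong (κ ^ᵈ N *_) (∑-allFamilies-zero (suc N) (value xs))) (value-initial N xs st)
    weighted-count N (suc t) xs ch | inj₁ st = begin
      κ ^ᵈ N * ∑ (allFamilies (suc N) (suc t)) (value xs)
        ≡⟨ cong (κ ^ᵈ N *_) (∑-allFamilies-suc (suc N) t (value xs)) ⟩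
      κ ^ᵈ N * ∑steps (suc N) (λ σ → ∑ (allFamilies (suc N) t) (λ f → value xs (prepend σ f)))
        ≡⟨ cong (κ ^ᵈ N *_) (∑steps-cong (suc N) (λ σ → trans
             (∑-cong (allFamilies (suc N) t) (value-prepend xs (strict⇒distinct st) σ))
             (∑-scale (weights xs) (allFamilies (suc N) t)))) ⟩
      κ ^ᵈ N * ∑steps (suc N) (λ σ → weights xs * W σ)
        ≡⟨ cong (κ ^ᵈ N *_) (∑steps-scale (suc N) (weights xs) W) ⟩
      κ ^ᵈ N * (weights xs * ∑steps (suc N) W)
        ≡⟨ rearrange (κ ^ᵈ N) (weights xs) _ ⟩
      weights xs * (κ ^ᵈ N * ∑steps (suc N) W)
        ≡⟨ cong (weights xs *_) (∑steps-scale (suc N) (κ ^ᵈ N) W) ⟨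
      weights xs * ∑steps (suc N) (λ σ → κ ^ᵈ N * W σ)
        ≡⟨ cong (weights xs *_) (∑steps-cong (suc N) (λ σ → weighted-count N t (move xs σ) (move-chain st σ))) ⟩
      weights xs * ∑steps (suc N) (λ σ → rowDet (λ j → j) (suc N) (map (row t) (toList (move xs σ))))
        ≡⟨ rowDet-step t (λ j → j) (suc N) xs ⟨
      rowDet (λ j → j) (suc N) (map (row (suc t)) (toList xs)) ∎
      where
      W : Vec Step (suc N) → Dual
      W σ = ∑ (allFamilies (suc N) t) (value (move xs σ))

-- The weight κ = 2 to first order, and the reduction of the rows.

module CriticalWeight where
  open DualNumbers
  open Determinants
  open Families
  open WeightedWalks
  import Tactic.RingSolver as Solver
  open import Data.Nat as ℕ using (ℕ; zero; suc)
  import Data.Nat.Properties as ℕ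
  open import Data.Integer as ℤ using (ℤ; +_; -[1+_])
  import Data.Integer.Properties as ℤ
  import Data.Integer.Tactic.RingSolver as ℤ-Solver
  open import Data.Fin using (Fin; toℕ)
  open import Data.List using (_∷_; []; map; applyUpTo; allFin; tabulate)
  open import Data.List.Properties using (map-tabulate; map-applyUpTo)
  open import Data.List.Relation.Unary.All.Properties using (applyUpTo⁺₂)
  open import Data.Vec using (toList)
  open import Function using (_∘_; id)
  open import Relation.Binary.PropositionalEquality
  open ≡-Reasoning

  -- This is 2 (1 + ε), with c-th power 2^c (1 + cε): the factor 2 at ε makes the infinitesimal part
  -- that of κ d/dκ instead of d/dκ.
  κ : Dual
  κ = + 2 +ε + 2

  open Weighted κ

  -- The doubling at height 0 is what a function even in the height inherits from the free
  -- recurrence. Hence A m x is 2 C(m , (m - x)/2) when m - x is even and nonnegative, and 0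
  -- otherwise.
  A B : ℕ → ℕ → ℤ
  A zero    zero    = + 2
  A zero    (suc x) = + 0
  A (suc m) zero    = + 2 ℤ.* A m 1
  A (suc m) (suc x) = A m (suc (suc x)) ℤ.+ A m x
  B zero    zero    = + 2
  B zero    (suc x) = + 0
  B (suc m) zero    = + 2 ℤ.* (B m 1 ℤ.+ A m 1)
  B (suc m) (suc x) = B m (suc (suc x)) ℤ.+ B m x

  private
    +-identityʳ : ∀ x → x + 0# ≡ x
    +-identityʳ = Solver.solve-∀ solverRing

  toAxis-parts : ∀ m x → toAxis m (+ x) ≡ A m x +ε B m x
  toAxis-parts zero    zero    = refl
  toAxis-parts zero    (suc x) = refl
  toAxis-parts (suc m) zero    = begin
    κ * (toAxis m (+ 1) + toAxis m -[1+ 0 ])  ≡⟨ cong₂ (λ u v → κ * (u + v)) (toAxis-parts m 1) (toAxis-negative m 0) ⟩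
    κ * ((A m 1 +ε B m 1) + 0#)                ≡⟨ cong (κ *_) (+-identityʳ (A m 1 +ε B m 1)) ⟩
    κ * (A m 1 +ε B m 1)                       ≡⟨ cong (+ 2 ℤ.* A m 1 +ε_) (sym (ℤ.*-distribˡ-+ (+ 2) (B m 1) (A m 1))) ⟩
    + 2 ℤ.* A m 1 +ε + 2 ℤ.* (B m 1 ℤ.+ A m 1) ∎
  toAxis-parts (suc m) (suc x) = trans (*-identityˡ _)
    (cong₂ _+_ (trans (cong (toAxis m ∘ +_) (ℕ.+-comm (suc x) 1)) (toAxis-parts m (suc (suc x)))) (toAxis-parts m x))

  -- E m is 2^(m+1) for even m and 0 for odd m; O m the other way round.
  E O : ℕ → ℤ
  E zero    = + 2
  E (suc m) = + 2 ℤ.* O m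
  O zero    = + 0
  O (suc m) = + 2 ℤ.* E m

  private
    double : ∀ b₂ b₀ a₂ a₀ → b₂ ℤ.+ b₀ ℤ.+ (a₂ ℤ.+ a₀) ≡ (b₂ ℤ.+ a₂ ℤ.+ a₀) ℤ.+ b₀
    double = ℤ-Solver.solve-∀
    two : ∀ x → x ℤ.+ x ≡ + 2 ℤ.* x
    two = ℤ-Solver.solve-∀
    boundary : ∀ b₃ b₁ a₃ a₁ → b₃ ℤ.+ b₁ ℤ.+ (a₃ ℤ.+ a₁) ℤ.+ + 2 ℤ.* a₁ ≡ (b₃ ℤ.+ a₃ ℤ.+ a₁) ℤ.+ (b₁ ℤ.+ + 2 ℤ.* a₁)
    boundary = ℤ-Solver.solve-∀
    boundary′ : ∀ b₁ a₁ → b₁ ℤ.+ (b₁ ℤ.+ + 2 ℤ.* a₁) ≡ + 2 ℤ.* (b₁ ℤ.+ a₁)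
    boundary′ = ℤ-Solver.solve-∀
    interior : ∀ b₄ b₂ a₄ a₂ a₀ → b₄ ℤ.+ b₂ ℤ.+ (a₄ ℤ.+ a₂) ℤ.+ (a₂ ℤ.+ a₀) ≡ (b₄ ℤ.+ a₄ ℤ.+ a₂) ℤ.+ (b₂ ℤ.+ a₂ ℤ.+ a₀)
    interior = ℤ-Solver.solve-∀

  -- This makes the infinitesimal part of `differenceRow` vanish. Above the axis it is inherited
  -- through the free recurrence; at height 0 the instance at height 1 absorbs the boundary terms.
  B-gap : ∀ m x → B m (suc (suc x)) ℤ.+ A m (suc (suc x)) ℤ.+ A m x ≡ B m x
  B-gap zero    zero    = refl
  B-gap zero    (suc x) = refl
  B-gap (suc m) zero    = trans (boundary (B m 3) (B m 1) (A m 3) (A m 1))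
    (trans (cong (ℤ._+ (B m 1 ℤ.+ + 2 ℤ.* A m 1)) (B-gap m 1)) (boundary′ (B m 1) (A m 1)))
  B-gap (suc m) (suc x) = trans (interior (B m (4 ℕ.+ x)) (B m (2 ℕ.+ x)) (A m (4 ℕ.+ x)) (A m (2 ℕ.+ x)) (A m x))
    (cong₂ ℤ._+_ (B-gap m (suc (suc x))) (B-gap m x))

  -- `B-gap` at height 0 decouples the boundary: passing to the next length, B m 0 and B m 1 + A m 1
  -- determine each other by mere doubling.
  B-boundary : ∀ m → B m 0 ≡ E m
  B-one      : ∀ m → B m 1 ℤ.+ A m 1 ≡ O m
  B-boundary zero    = refl
  B-boundary (suc m) = cong (+ 2 ℤ.*_) (B-one m)
  B-one zero    = refl
  B-one (suc m) = begin
    B m 2 ℤ.+ B m 0 ℤ.+ (A m 2 ℤ.+ A m 0) ≡⟨ double (B m 2) (B m 0) (A m 2) (A m 0) ⟩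
    (B m 2 ℤ.+ A m 2 ℤ.+ A m 0) ℤ.+ B m 0 ≡⟨ cong (ℤ._+ B m 0) (B-gap m 0) ⟩
    B m 0 ℤ.+ B m 0                       ≡⟨ two (B m 0) ⟩
    + 2 ℤ.* B m 0                         ≡⟨ cong (+ 2 ℤ.*_) (B-boundary m) ⟩
    + 2 ℤ.* E m                           ∎

  E-even : ∀ p → E (2 ℕ.* p) ≡ + 2 ℤ.* (+ 4) ℤ.^ p
  E-even zero    = refl
  E-even (suc p) = begin
    E (2 ℕ.* suc p)                ≡⟨ cong E (ℕ.*-suc 2 p) ⟩
    + 2 ℤ.* (+ 2 ℤ.* E (2 ℕ.* p))  ≡⟨ cong (λ u → + 2 ℤ.* (+ 2 ℤ.* u)) (E-even p) ⟩
    + 2 ℤ.* (+ 2 ℤ.* (+ 2 ℤ.* q))  ≡⟨ assoc q ⟩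
    + 2 ℤ.* (+ 4 ℤ.* q)            ∎
    where
    q = (+ 4) ℤ.^ p
    assoc : ∀ q → + 2 ℤ.* (+ 2 ℤ.* (+ 2 ℤ.* q)) ≡ + 2 ℤ.* (+ 4 ℤ.* q)
    assoc = ℤ-Solver.solve-∀

  toList-start : ∀ {Y : Set} (f : ℤ → Y) k c n → (∀ i → c i ≡ k ℕ.+ i) →
                 map f (toList (start k n)) ≡ applyUpTo (λ i → f (+ (2 ℕ.* c i))) n
  toList-start f k c zero    h = refl
  toList-start f k c (suc n) h = cong₂ _∷_
    (cong (λ i → f (+ (2 ℕ.* i))) (sym (trans (h 0) (ℕ.+-identityʳ k))))
    (toList-start f (suc k) (c ∘ suc) n (λ i → trans (h (suc i)) (ℕ.+-suc k i)))

  applyUpTo-tabulate : ∀ {Y : Set} (f : ℕ → Y) n → applyUpTo f n ≡ tabulate {n = n} (f ∘ toℕ)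
  applyUpTo-tabulate f zero    = refl
  applyUpTo-tabulate f (suc n) = cong (f 0 ∷_) (applyUpTo-tabulate (f ∘ suc) n)

  module _ (N r : ℕ) where
    open Contraction

    private
      len : ℕ → ℕ
      len j = 2 ℕ.* r ℕ.+ 2 ℕ.* j

    -- `differenceRow i` is (1 - ε) ((κ - 1) `walkRow (suc i)` - `walkRow i`). With z (λ + 1/λ) = 1,
    -- the generating function of `toAxis m x` over z^m is κ (1 + λ²) λ^x / (1 - (κ - 1) λ²). The
    -- combination thus clears the denominator, and κ (1 - ε) = 2 removes the remaining ε.
    walkRow reducedRow differenceRow : ℕ → ℕ → Dual
    walkRow i = row (2 ℕ.* r) (+ (2 ℕ.* i))
    reducedRow i j = A (len j) (2 ℕ.* i) +ε E (len j)
    differenceRow i j = (+ 1 +ε + 1) * walkRow (suc i) j + (-[1+ 0 ] +ε + 1) * walkRow i j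

    private
      ep-part : ∀ a′ b′ a b e → b′ ℤ.+ a′ ℤ.+ a ≡ b →
        (+ 1 ℤ.* b′ ℤ.+ + 1 ℤ.* a′) ℤ.+ (-[1+ 0 ] ℤ.* b ℤ.+ + 1 ℤ.* a) ≡
        (+ 1 ℤ.* e ℤ.+ + 0 ℤ.* a′) ℤ.+ (-[1+ 0 ] ℤ.* e ℤ.+ + 0 ℤ.* a)
      ep-part a′ b′ a _ e refl = lemma a′ b′ a e
        where
        lemma : ∀ a′ b′ a e →
          (+ 1 ℤ.* b′ ℤ.+ + 1 ℤ.* a′) ℤ.+ (-[1+ 0 ] ℤ.* (b′ ℤ.+ a′ ℤ.+ a) ℤ.+ + 1 ℤ.* a) ≡
          (+ 1 ℤ.* e ℤ.+ + 0 ℤ.* a′) ℤ.+ (-[1+ 0 ] ℤ.* e ℤ.+ + 0 ℤ.* a)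
        lemma = ℤ-Solver.solve-∀
      same : ∀ u v → u ≡ 1# * u + 0# * v
      same = Solver.solve-∀ solverRing
      one-pow : ∀ n → 1# ^ᵈ n ≡ 1#
      one-pow zero    = refl
      one-pow (suc n) = trans (*-identityˡ _) (one-pow n)

    difference-reduced : ∀ i j → differenceRow i j ≡ 1# * reducedRow (suc i) j + - 1# * reducedRow i j
    difference-reduced i j
      rewrite toAxis-parts (len j) (2 ℕ.* i) | toAxis-parts (len j) (2 ℕ.* suc i) | ℕ.*-suc 2 i
      = combine (A m (2 ℕ.+ 2 ℕ.* i)) (B m (2 ℕ.+ 2 ℕ.* i)) (A m (2 ℕ.* i)) (B m (2 ℕ.* i)) (E m) (B-gap m (2 ℕ.* i))
      where
      m = len j
      combine : ∀ a′ b′ a b e → b′ ℤ.+ a′ ℤ.+ a ≡ b →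
        (+ 1 +ε + 1) * (a′ +ε b′) + (-[1+ 0 ] +ε + 1) * (a +ε b) ≡ 1# * (a′ +ε e) + - 1# * (a +ε e)
      combine a′ b′ a b e g = cong (+ 1 ℤ.* a′ ℤ.+ -[1+ 0 ] ℤ.* a +ε_) (ep-part a′ b′ a b e g)

    walk-reduced : ∀ j → walkRow 0 j ≡ reducedRow 0 j
    walk-reduced j = trans (toAxis-parts (len j) 0) (cong (A (len j) 0 +ε_) (B-boundary (len j)))

    reduce-rows : rowDet id (suc N) (applyUpTo reducedRow (suc N)) ≡
                  (+ 1 +ε + 1) ^ᵈ N * rowDet id (suc N) (applyUpTo walkRow (suc N))
    reduce-rows = begin
      D (applyUpTo reducedRow (suc N))
        ≡⟨ trans (cong (_* D (applyUpTo reducedRow (suc N))) (one-pow N)) (*-identityˡ _) ⟨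
      1# ^ᵈ N * D (applyUpTo reducedRow (suc N))
        -- Reduced rows and walk rows share row 0 and the difference rows, so both determinants are
        -- compared with the one built from these.
        ≡⟨ bidiagonal-rows {F = D} {x = reducedRow} (λ i → det-splits {a = 1#} { - 1# } (applyUpTo⁺₂ entry (suc N) (difference-reduced i))) alt N ⟨
      D (reducedRow 0 ∷ applyUpTo differenceRow N)
        -- The two versions of row 0 agree only pointwise, so the replacement is made as a splitting
        -- with coefficients 1 and 0.
        ≡⟨ det-splits {b = 0#} {y = reducedRow 0} (applyUpTo⁺₂ entry (suc N) (λ j → trans (sym (walk-reduced j)) (same (walkRow 0 j) (reducedRow 0 j)))) [] _ ⟩
      1# * D (walkRow 0 ∷ applyUpTo differenceRow N) + 0# * D (reducedRow 0 ∷ applyUpTo differenceRow N)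
        ≡⟨ same _ _ ⟨
      D (walkRow 0 ∷ applyUpTo differenceRow N)
        ≡⟨ bidiagonal-rows {F = D} (λ i → det-splits (applyUpTo⁺₂ entry (suc N) (λ j → refl))) alt N ⟩
      (+ 1 +ε + 1) ^ᵈ N * D (applyUpTo walkRow (suc N)) ∎
      where
      D = rowDet id (suc N)
      alt = det-alternating (applyUpTo entry (suc N))

    -- The row index is confined to i ≤ N, the range in which the rescaled entries are polynomials
    -- of degree N.
    column : ℕ → Fin (suc N) → Dual
    column j i = reducedRow (toℕ i) j

    columns-reduced : rowDet id (suc N) (applyUpTo reducedRow (suc N)) ≡ det (applyUpTo column (suc N)) (allFin (suc N))
    columns-reduced = begin
      det (applyUpTo entry (suc N)) (applyUpTo reducedRow (suc N))
        ≡⟨ cong (det (applyUpTo entry (suc N))) (trans (applyUpTo-tabulate reducedRow (suc N)) (sym (map-tabulate id (reducedRow ∘ toℕ)))) ⟩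
      det (applyUpTo entry (suc N)) (map (reducedRow ∘ toℕ) (allFin (suc N)))
        ≡⟨ det-map (reducedRow ∘ toℕ) (applyUpTo entry (suc N)) (allFin (suc N)) ⟩
      det (map (_∘ (reducedRow ∘ toℕ)) (applyUpTo entry (suc N))) (allFin (suc N))
        ≡⟨ cong (λ φs → det φs (allFin (suc N))) (map-applyUpTo entry _ (suc N)) ⟩
      det (applyUpTo column (suc N)) (allFin (suc N)) ∎

    reduced-count : κ ^ᵈ N * (+ 1 +ε + 1) ^ᵈ N * ∑ (allFamilies (suc N) (2 ℕ.* r)) (value (start 0 (suc N)))
                    ≡ det (applyUpTo column (suc N)) (allFin (suc N))
    reduced-count = begin
      κ ^ᵈ N * (+ 1 +ε + 1) ^ᵈ N * W
        ≡⟨ rearrange (κ ^ᵈ N) ((+ 1 +ε + 1) ^ᵈ N) W ⟩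
      (+ 1 +ε + 1) ^ᵈ N * (κ ^ᵈ N * W)
        ≡⟨ cong ((+ 1 +ε + 1) ^ᵈ N *_) (weighted-count N (2 ℕ.* r) (start 0 (suc N)) (weaken (packed-strict 0 (suc N)))) ⟩
      (+ 1 +ε + 1) ^ᵈ N * rowDet id (suc N) (map (row (2 ℕ.* r)) (toList (start 0 (suc N))))
        ≡⟨ cong (λ xs → (+ 1 +ε + 1) ^ᵈ N * rowDet id (suc N) xs) (toList-start (row (2 ℕ.* r)) 0 id (suc N) (λ _ → refl)) ⟩
      (+ 1 +ε + 1) ^ᵈ N * rowDet id (suc N) (applyUpTo walkRow (suc N))
        ≡⟨ reduce-rows ⟨
      rowDet id (suc N) (applyUpTo reducedRow (suc N))
        ≡⟨ columns-reduced ⟩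
      det (applyUpTo column (suc N)) (allFin (suc N)) ∎
      where
      W = ∑ (allFamilies (suc N) (2 ℕ.* r)) (value (start 0 (suc N)))
      rearrange : ∀ k a w → k * a * w ≡ a * (k * w)
      rearrange = Solver.solve-∀ solverRing

-- Closed forms of the entries and their finite differences.

module FiniteDifferences where
  open CriticalWeight using (A; E; E-even)
  open import Data.Nat as ℕ using (ℕ; zero; suc; s≤s; _!; _∸_)
  import Data.Nat.Properties as ℕ
  import Data.Nat.Tactic.RingSolver as ℕ-Solver
  open import Data.Integer as ℤ using (ℤ; +_; _+_; _*_; _-_; -_)
  import Data.Integer.Properties as ℤ
  import Data.Integer.Tactic.RingSolver as ℤ-Solver
  open import Data.List using (List; []; _∷_; _++_; length)
  open import Data.List.Properties using (length-++)
  open import Relation.Nullary using (yes; no)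
  open import Relation.Binary.PropositionalEquality
  open ≡-Reasoning

  fac : ℕ → ℤ
  fac n = + (n !)

  fac-suc : ∀ n → fac (suc n) ≡ + suc n * fac n
  fac-suc n = ℤ.pos-* (suc n) (n !)

  A-far : ∀ m d → A m (m ℕ.+ suc d) ≡ + 0
  A-far zero    d = refl
  A-far (suc m) d = cong₂ _+_
    (trans (cong (A m) (up m d)) (A-far m (suc (suc d)))) (A-far m d)
    where
    up : ∀ m d → suc (suc (m ℕ.+ suc d)) ≡ m ℕ.+ suc (suc (suc d))
    up = ℕ-Solver.solve-∀

  private
    2[1+p] : ∀ p → 2 ℕ.* suc p ≡ suc (2 ℕ.* p ℕ.+ 1)
    2[1+p] = ℕ-Solver.solve-∀
    up₂ : ∀ p x → 2 ℕ.* p ℕ.+ suc (suc x) ≡ 2 ℕ.* suc p ℕ.+ x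
    up₂ = ℕ-Solver.solve-∀
    cast : ∀ p x → + suc p + + suc (p ℕ.+ suc x) ≡ + (2 ℕ.* suc p ℕ.+ suc x)
    cast p x = cong +_ (lemma p x)
      where
      lemma : ∀ p x → suc p ℕ.+ suc (p ℕ.+ suc x) ≡ 2 ℕ.* suc p ℕ.+ suc x
      lemma = ℕ-Solver.solve-∀

  -- This is A m x = 2 C(m , p) cleared of denominators, by Pascal's rule. At height 0 the doubling
  -- is the symmetry C(2p + 1 , p) = C(2p + 1 , p + 1).
  A-closed : ∀ m p x → m ≡ 2 ℕ.* p ℕ.+ x → A m x * (fac p * fac (p ℕ.+ x)) ≡ + 2 * fac m
  A-closed zero    zero    zero    q = refl
  A-closed (suc m) zero    (suc x) q with ℕ.suc-injective q
  ... | refl = begin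
    (A x (suc (suc x)) + A x x) * (+ 1 * fac (suc x))
      ≡⟨ cong₂ (λ u v → (u + A x x) * (+ 1 * v)) (trans (cong (A x) (ℕ.+-comm 2 x)) (A-far x 1)) (fac-suc x) ⟩
    (+ 0 + A x x) * (+ 1 * (+ suc x * fac x))
      ≡⟨ lemma (A x x) (+ suc x) (fac x) ⟩
    + suc x * (A x x * (+ 1 * fac x))
      ≡⟨ cong (+ suc x *_) (A-closed x zero x refl) ⟩
    + suc x * (+ 2 * fac x)
      ≡⟨ lemma′ (+ suc x) (fac x) ⟩
    + 2 * (+ suc x * fac x)
      ≡⟨ cong (+ 2 *_) (fac-suc x) ⟨
    + 2 * fac (suc x) ∎
    where
    lemma : ∀ a s f → (+ 0 + a) * (+ 1 * (s * f)) ≡ s * (a * (+ 1 * f))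
    lemma = ℤ-Solver.solve-∀
    lemma′ : ∀ s f → s * (+ 2 * f) ≡ + 2 * (s * f)
    lemma′ = ℤ-Solver.solve-∀
  A-closed (suc m) (suc p) zero q = begin
    (+ 2 * A m 1) * (fac (suc p) * fac (suc p ℕ.+ 0))
      ≡⟨ cong₂ (λ u v → (+ 2 * A m 1) * (u * v)) (fac-suc p) (cong fac (sym (ℕ.+-suc p 0))) ⟩
    (+ 2 * A m 1) * (+ suc p * fac p * fac (p ℕ.+ 1))
      ≡⟨ lemma (A m 1) (+ suc p) (fac p) (fac (p ℕ.+ 1)) ⟩
    (+ 2 * + suc p) * (A m 1 * (fac p * fac (p ℕ.+ 1)))
      ≡⟨ cong₂ _*_ (trans (sym (ℤ.pos-* 2 (suc p))) (cong +_ (trans (sym (ℕ.+-identityʳ _)) (sym q)))) (A-closed m p 1 (ℕ.suc-injective (trans q (trans (ℕ.+-identityʳ _) (2[1+p] p))))) ⟩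
    + suc m * (+ 2 * fac m)
      ≡⟨ lemma′ (+ suc m) (fac m) ⟩
    + 2 * (+ suc m * fac m)
      ≡⟨ cong (+ 2 *_) (fac-suc m) ⟨
    + 2 * fac (suc m) ∎
    where
    lemma : ∀ a s f g → (+ 2 * a) * (s * f * g) ≡ (+ 2 * s) * (a * (f * g))
    lemma = ℤ-Solver.solve-∀
    lemma′ : ∀ s f → s * (+ 2 * f) ≡ + 2 * (s * f)
    lemma′ = ℤ-Solver.solve-∀
  A-closed (suc m) (suc p) (suc x) q = begin
    (A m (suc (suc x)) + A m x) * (fac (suc p) * fac (suc p ℕ.+ suc x))
      ≡⟨ expand ⟩
    + suc p * (A m (suc (suc x)) * (fac p * fac (p ℕ.+ suc (suc x)))) + + suc (p ℕ.+ suc x) * (A m x * (fac (suc p) * fac (suc p ℕ.+ x)))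
      ≡⟨ cong₂ (λ u v → + suc p * u + + suc (p ℕ.+ suc x) * v)
           (A-closed m p (suc (suc x)) (trans q′ (sym (up₂ p x)))) (A-closed m (suc p) x q′) ⟩
    + suc p * (+ 2 * fac m) + + suc (p ℕ.+ suc x) * (+ 2 * fac m)
      ≡⟨ collect (+ suc p) (+ suc (p ℕ.+ suc x)) (fac m) ⟩
    + 2 * ((+ suc p + + suc (p ℕ.+ suc x)) * fac m)
      ≡⟨ cong (λ u → + 2 * (u * fac m)) (trans (cast p x) (cong +_ (sym q))) ⟩
    + 2 * (+ suc m * fac m)
      ≡⟨ cong (+ 2 *_) (fac-suc m) ⟨
    + 2 * fac (suc m) ∎
    where
    q′ : m ≡ 2 ℕ.* suc p ℕ.+ x
    q′ = ℕ.suc-injective (trans q (ℕ.+-suc (2 ℕ.* suc p) x))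
    collect : ∀ a b f → a * (+ 2 * f) + b * (+ 2 * f) ≡ + 2 * ((a + b) * f)
    collect = ℤ-Solver.solve-∀
    lemma : ∀ a₂ a₀ s t f g h → g ≡ s * f →
      (a₂ + a₀) * (g * (t * h)) ≡ s * (a₂ * (f * (t * h))) + t * (a₀ * (g * h))
    lemma a₂ a₀ s t f _ h refl = poly a₂ a₀ s t f h
      where
      poly : ∀ a₂ a₀ s t f h → (a₂ + a₀) * (s * f * (t * h)) ≡ s * (a₂ * (f * (t * h))) + t * (a₀ * (s * f * h))
      poly = ℤ-Solver.solve-∀
    expand : (A m (suc (suc x)) + A m x) * (fac (suc p) * fac (suc p ℕ.+ suc x)) ≡
             + suc p * (A m (suc (suc x)) * (fac p * fac (p ℕ.+ suc (suc x)))) + + suc (p ℕ.+ suc x) * (A m x * (fac (suc p) * fac (suc p ℕ.+ x)))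
    expand = begin
      (A m (suc (suc x)) + A m x) * (fac (suc p) * fac (suc p ℕ.+ suc x))
        ≡⟨ cong (λ u → (A m (suc (suc x)) + A m x) * (fac (suc p) * u)) h ⟩
      (A m (suc (suc x)) + A m x) * (fac (suc p) * (+ suc (p ℕ.+ suc x) * fac (suc p ℕ.+ x)))
        ≡⟨ lemma (A m (suc (suc x))) (A m x) (+ suc p) (+ suc (p ℕ.+ suc x)) (fac p) (fac (suc p)) (fac (suc p ℕ.+ x)) (fac-suc p) ⟩
      + suc p * (A m (suc (suc x)) * (fac p * (+ suc (p ℕ.+ suc x) * fac (suc p ℕ.+ x)))) + + suc (p ℕ.+ suc x) * (A m x * (fac (suc p) * fac (suc p ℕ.+ x)))
        ≡⟨ cong (λ u → + suc p * (A m (suc (suc x)) * (fac p * u)) + + suc (p ℕ.+ suc x) * (A m x * (fac (suc p) * fac (suc p ℕ.+ x)))) (trans (sym h) (cong fac (sym (ℕ.+-suc p (suc x))))) ⟩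
      + suc p * (A m (suc (suc x)) * (fac p * fac (p ℕ.+ suc (suc x)))) + + suc (p ℕ.+ suc x) * (A m x * (fac (suc p) * fac (suc p ℕ.+ x))) ∎
      where
      h : fac (suc p ℕ.+ suc x) ≡ + suc (p ℕ.+ suc x) * fac (suc p ℕ.+ x)
      h = trans (fac-suc (p ℕ.+ suc x)) (cong (λ i → + suc (p ℕ.+ suc x) * fac i) (ℕ.+-suc p x))

  δ : ℕ → (ℕ → ℤ) → ℕ → ℤ
  δ zero    f j = f j
  δ (suc k) f j = δ k f (suc j) - δ k f j

  δ-cong : ∀ k j {f g} → (∀ i → i ℕ.≤ j ℕ.+ k → f i ≡ g i) → δ k f j ≡ δ k g j
  δ-cong zero    j h = h j (ℕ.m≤m+n j 0)
  δ-cong (suc k) j h = cong₂ _-_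
    (δ-cong k (suc j) (λ i l → h i (subst (i ℕ.≤_) (sym (ℕ.+-suc j k)) l)))
    (δ-cong k j (λ i l → h i (ℕ.≤-trans l (ℕ.+-monoʳ-≤ j (ℕ.n≤1+n k)))))

  δ-scale : ∀ k j c f → δ k (λ i → c * f i) j ≡ c * δ k f j
  δ-scale zero    j c f = refl
  δ-scale (suc k) j c f = trans (cong₂ _-_ (δ-scale k (suc j) c f) (δ-scale k j c f)) (lemma c _ _)
    where
    lemma : ∀ c u v → c * u - c * v ≡ c * (u - v)
    lemma = ℤ-Solver.solve-∀

  -- The linear factor has first difference 1 and vanishing higher ones, so only two terms of the
  -- product rule survive.
  δ-leibniz : ∀ k j c f → δ (suc k) (λ i → (+ i + c) * f i) j ≡ (+ j + c) * δ (suc k) f j + + suc k * δ k f (suc j)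
  δ-leibniz zero j c f = lemma (+ j) c (f (suc j)) (f j)
    where
    lemma : ∀ j c u v → (+ 1 + j + c) * u - (j + c) * v ≡ (j + c) * (u - v) + + 1 * u
    lemma = ℤ-Solver.solve-∀
  δ-leibniz (suc k) j c f = trans (cong₂ _-_ (δ-leibniz k (suc j) c f) (δ-leibniz k j c f))
    (lemma (+ j) (+ suc k) c (δ k f (suc (suc j))) (δ k f (suc j)) (δ (suc k) f j))
    where
    lemma : ∀ j k c f₂ f₁ d₀ →
      ((+ 1 + j + c) * (f₂ - f₁) + k * f₂) - ((j + c) * d₀ + k * f₁) ≡
      (j + c) * ((f₂ - f₁) - d₀) + (+ 1 + k) * (f₂ - f₁)
    lemma = ℤ-Solver.solve-∀

  ∏ : List ℤ → ℤ → ℤ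
  ∏ []       y = + 1
  ∏ (c ∷ cs) y = (y + c) * ∏ cs y

  ∏-++ : ∀ cs ds y → ∏ (cs ++ ds) y ≡ ∏ cs y * ∏ ds y
  ∏-++ []       ds y = sym (ℤ.*-identityˡ _)
  ∏-++ (c ∷ cs) ds y = trans (cong ((y + c) *_) (∏-++ cs ds y)) (sym (ℤ.*-assoc (y + c) (∏ cs y) (∏ ds y)))

  -- The length of the list is the degree. By induction the lower difference is constant, so the
  -- first Leibniz term drops out and the second multiplies the factorial.
  δ-monic : ∀ cs j → δ (length cs) (λ i → ∏ cs (+ i)) j ≡ fac (length cs)
  δ-monic []       j = refl
  δ-monic (c ∷ cs) j = begin
    δ (suc k) (λ i → (+ i + c) * ∏ cs (+ i)) j
      ≡⟨ δ-leibniz k j c (λ i → ∏ cs (+ i)) ⟩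
    (+ j + c) * (δ k (λ i → ∏ cs (+ i)) (suc j) - δ k (λ i → ∏ cs (+ i)) j) + + suc k * δ k (λ i → ∏ cs (+ i)) (suc j)
      ≡⟨ cong₂ (λ u v → (+ j + c) * (u - v) + + suc k * u) (δ-monic cs (suc j)) (δ-monic cs j) ⟩
    (+ j + c) * (fac k - fac k) + + suc k * fac k
      ≡⟨ lemma (+ j + c) (fac k) (+ suc k) ⟩
    + suc k * fac k
      ≡⟨ fac-suc k ⟨
    fac (suc k) ∎
    where
    k = length cs
    lemma : ∀ u f s → u * (f - f) + s * f ≡ s * f
    lemma = ℤ-Solver.solve-∀

  -- The products over these lists at y are the falling and the rising factorials of y + x.
  down up : ℤ → ℕ → List ℤ
  down x zero    = []
  down x (suc i) = x ∷ down (x - + 1) i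
  up x zero    = []
  up x (suc d) = x ∷ up (x + + 1) d

  length-down : ∀ x i → length (down x i) ≡ i
  length-down x zero    = refl
  length-down x (suc i) = cong suc (length-down (x - + 1) i)

  length-up : ∀ x d → length (up x d) ≡ d
  length-up x zero    = refl
  length-up x (suc d) = cong suc (length-up (x + + 1) d)

  private
    lower : ∀ y x m → y + x ≡ + suc m → y + (x - + 1) ≡ + m
    lower y x m q = trans (sym (ℤ.+-assoc y x (- + 1))) (trans (cong (_- + 1) q) (lemma (+ m)))
      where
      lemma : ∀ m → (+ 1 + m) - + 1 ≡ m
      lemma = ℤ-Solver.solve-∀
    raise : ∀ y x m → y + x ≡ + m → y + (x + + 1) ≡ + suc m
    raise y x m q = trans (sym (ℤ.+-assoc y x (+ 1))) (trans (cong (_+ + 1) q) (ℤ.+-comm (+ m) (+ 1)))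

  ∏-down : ∀ i {m} p {x y} → y + x ≡ + m → m ≡ p ℕ.+ i → ∏ (down x i) y * fac p ≡ fac m
  ∏-down zero    p q refl = trans (ℤ.*-identityˡ _) (cong fac (sym (ℕ.+-identityʳ p)))
  ∏-down (suc i) p {x} {y} q refl = begin
    (y + x) * ∏ (down (x - + 1) i) y * fac p
      ≡⟨ ℤ.*-assoc (y + x) (∏ (down (x - + 1) i) y) (fac p) ⟩
    (y + x) * (∏ (down (x - + 1) i) y * fac p)
      ≡⟨ cong₂ _*_ q′ (∏-down i p (lower y x (p ℕ.+ i) q′) refl) ⟩
    + suc (p ℕ.+ i) * fac (p ℕ.+ i)
      ≡⟨ fac-suc (p ℕ.+ i) ⟨
    fac (suc (p ℕ.+ i))
      ≡⟨ cong fac (ℕ.+-suc p i) ⟨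
    fac (p ℕ.+ suc i) ∎
    where
    q′ : y + x ≡ + suc (p ℕ.+ i)
    q′ = trans q (cong +_ (ℕ.+-suc p i))

  ∏-down-zero : ∀ i {m x y} → y + x ≡ + m → m ℕ.< i → ∏ (down x i) y ≡ + 0
  ∏-down-zero (suc i) {zero}  {x} {y} q l = cong (_* ∏ (down (x - + 1) i) y) q
  ∏-down-zero (suc i) {suc m} {x} {y} q (s≤s l) =
    trans (cong ((y + x) *_) (∏-down-zero i (lower y x m q) l)) (ℤ.*-zeroʳ (y + x))

  ∏-up : ∀ d m {x y} → y + x ≡ + suc m → ∏ (up x d) y * fac m ≡ fac (m ℕ.+ d)
  ∏-up zero    m q = trans (ℤ.*-identityˡ _) (cong fac (sym (ℕ.+-identityʳ m)))
  ∏-up (suc d) m {x} {y} q = begin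
    (y + x) * ∏ (up (x + + 1) d) y * fac m
      ≡⟨ cong (λ u → u * ∏ (up (x + + 1) d) y * fac m) q ⟩
    + suc m * ∏ (up (x + + 1) d) y * fac m
      ≡⟨ lemma (+ suc m) (∏ (up (x + + 1) d) y) (fac m) ⟩
    ∏ (up (x + + 1) d) y * (+ suc m * fac m)
      ≡⟨ cong (∏ (up (x + + 1) d) y *_) (fac-suc m) ⟨
    ∏ (up (x + + 1) d) y * fac (suc m)
      ≡⟨ ∏-up d (suc m) (raise y x (suc m) q) ⟩
    fac (suc (m ℕ.+ d))
      ≡⟨ cong fac (ℕ.+-suc m d) ⟨
    fac (m ℕ.+ suc d) ∎
    where
    lemma : ∀ s u f → s * u * f ≡ u * (s * f)
    lemma = ℤ-Solver.solve-∀

  -- (2c+1)(2c+3)⋯, with d factors.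
  odd : ℕ → ℕ → ℤ
  odd c zero    = + 1
  odd c (suc d) = (+ 1 + + 2 * + c) * odd (suc c) d

  two : ℕ → ℤ
  two n = (+ 2) ℤ.^ n

  odd-+ : ∀ c a b → odd c (a ℕ.+ b) ≡ odd c a * odd (c ℕ.+ a) b
  odd-+ c zero    b = trans (cong (λ i → odd i b) (sym (ℕ.+-identityʳ c))) (sym (ℤ.*-identityˡ _))
  odd-+ c (suc a) b = trans (cong ((+ 1 + + 2 * + c) *_)
    (trans (odd-+ (suc c) a b) (cong (λ i → odd (suc c) a * odd i b) (sym (ℕ.+-suc c a)))))
    (sym (ℤ.*-assoc (+ 1 + + 2 * + c) (odd (suc c) a) _))

  odd-last : ∀ c d → odd c (suc d) ≡ odd c d * (+ 1 + + 2 * + (c ℕ.+ d))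
  odd-last c d = trans (cong (odd c) (ℕ.+-comm 1 d)) (trans (odd-+ c d 1) (cong (odd c d *_) (ℤ.*-identityʳ _)))

  -- The even factors of (2m)! give 2^m m!, the odd ones the double factorial.
  fac-double : ∀ m → fac (2 ℕ.* m) ≡ two m * fac m * odd 0 m
  fac-double zero    = refl
  fac-double (suc m) = begin
    fac (2 ℕ.* suc m)
      ≡⟨ cong fac (ℕ.*-suc 2 m) ⟩
    fac (suc (suc (2 ℕ.* m)))
      ≡⟨ trans (fac-suc (suc (2 ℕ.* m))) (cong (+ suc (suc (2 ℕ.* m)) *_) (fac-suc (2 ℕ.* m))) ⟩
    + suc (suc (2 ℕ.* m)) * (+ suc (2 ℕ.* m) * fac (2 ℕ.* m))
      ≡⟨ cong₂ (λ u v → (+ 2 + u) * ((+ 1 + u) * v)) (ℤ.pos-* 2 m) (fac-double m) ⟩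
    (+ 2 + + 2 * + m) * ((+ 1 + + 2 * + m) * (two m * fac m * odd 0 m))
      ≡⟨ lemma (+ m) (two m) (fac m) (odd 0 m) ⟩
    + 2 * two m * ((+ 1 + + m) * fac m) * (odd 0 m * (+ 1 + + 2 * + m))
      ≡⟨ cong₂ (λ u v → + 2 * two m * u * v) (sym (fac-suc m)) (sym (odd-last 0 m)) ⟩
    + 2 * two m * fac (suc m) * odd 0 (suc m) ∎
    where
    lemma : ∀ m t f o → (+ 2 + + 2 * m) * ((+ 1 + + 2 * m) * (t * f * o)) ≡ + 2 * t * ((+ 1 + m) * f) * (o * (+ 1 + + 2 * m))
    lemma = ℤ-Solver.solve-∀

  two-+ : ∀ a b → two (a ℕ.+ b) ≡ two a * two b
  two-+ a b = ℤ.^-distribˡ-+-* (+ 2) a b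

  four : ∀ m → (+ 4) ℤ.^ m ≡ two m * two m
  four zero    = refl
  four (suc m) = trans (cong (+ 4 *_) (four m)) (lemma (two m))
    where
    lemma : ∀ t → + 4 * (t * t) ≡ (+ 2 * t) * (+ 2 * t)
    lemma = ℤ-Solver.solve-∀

  fac≢0 : ∀ n → ℤ.NonZero (fac n)
  fac≢0 n = n ℕ.!≢0

  odd-nonZero : ∀ c d → ℤ.NonZero (odd c d)
  odd-nonZero c zero    = _
  odd-nonZero c (suc d) = ℤ.i*j≢0 (+ 1 + + 2 * + c) (odd (suc c) d) {{factor}} {{odd-nonZero (suc c) d}}
    where
    factor : ℤ.NonZero (+ 1 + + 2 * + c)
    factor = subst (λ u → ℤ.NonZero (+ 1 + u)) (ℤ.pos-* 2 c) _

  pow-nonZero : ∀ t n → ℤ.NonZero t → ℤ.NonZero (t ℤ.^ n)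
  pow-nonZero t zero    nz = _
  pow-nonZero t (suc n) nz = ℤ.i*j≢0 t (t ℤ.^ n) {{nz}} {{pow-nonZero t n nz}}

  two-nonZero : ∀ n → ℤ.NonZero (two n)
  two-nonZero n = pow-nonZero (+ 2) n _

  module Coefficients (N r : ℕ) where

    -- The Christoffel–Darboux kernel of the moments C(2m , m) with m ≥ r, at the endpoint 4 of the
    -- support, has coefficients proportional to (-1)^j (N choose j) (e j); in closed form e j is a
    -- multiple, not depending on j, of m! (m + N)! / (2m)! with m = r + j.
    e e₀ : ℕ → ℤ
    e j  = two (N ∸ j) * fac (r ℕ.+ j ℕ.+ N) * odd (r ℕ.+ j) (N ∸ j)
    e₀ j = two (r ℕ.+ j) * fac (r ℕ.+ j ℕ.+ N) * odd (r ℕ.+ j) (N ∸ j)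

    -- `leading` is (2r + 2N)! / (r + N)!. T is N! times the common leading coefficient of the
    -- rescaled real parts, S the N-th difference of the rescaled infinitesimal parts.
    leading T S : ℤ
    leading = two (r ℕ.+ N) * odd 0 (r ℕ.+ N)
    T = + 2 * leading * fac N
    S = + 2 * two (r ℕ.+ N) * (odd 1 N * (two r * fac (r ℕ.+ N)))

    private
      sum-gap : ∀ {j} → j ℕ.≤ N → r ℕ.+ j ℕ.+ (N ∸ j) ≡ r ℕ.+ N
      sum-gap {j} l = trans (ℕ.+-assoc r j (N ∸ j)) (cong (r ℕ.+_) (ℕ.m+[n∸m]≡n l))

    e-fac : ∀ j → j ℕ.≤ N → e j * fac (2 ℕ.* (r ℕ.+ j)) ≡ leading * (fac (r ℕ.+ j) * fac (r ℕ.+ j ℕ.+ N))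
    e-fac j l = begin
      e j * fac (2 ℕ.* m)
        ≡⟨ cong (e j *_) (fac-double m) ⟩
      e j * (two m * fac m * odd 0 m)
        ≡⟨ lemma (two d) (fac (m ℕ.+ N)) (odd m d) (two m) (fac m) (odd 0 m) ⟩
      (two m * two d) * (odd 0 m * odd m d) * (fac m * fac (m ℕ.+ N))
        ≡⟨ cong₂ (λ u v → u * v * (fac m * fac (m ℕ.+ N))) (sym (two-+ m d)) (sym (odd-+ 0 m d)) ⟩
      two (m ℕ.+ d) * odd 0 (m ℕ.+ d) * (fac m * fac (m ℕ.+ N))
        ≡⟨ cong (λ i → two i * odd 0 i * (fac m * fac (m ℕ.+ N))) (sum-gap l) ⟩
      leading * (fac m * fac (m ℕ.+ N)) ∎
      where
      m = r ℕ.+ j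
      d = N ∸ j
      lemma : ∀ a x o b f p → a * x * o * (b * f * p) ≡ (b * a) * (p * o) * (f * x)
      lemma = ℤ-Solver.solve-∀

    -- With m = r + j, the product at j is m!/(m - i)! times (m + N)!/(m + i)! for i ≤ m, which is
    -- what remains of the rescaled binomial once (2m)! has cancelled. The members are the negatives
    -- of the roots.
    monicRoots : ℕ → List ℤ
    monicRoots i = down (+ r) i ++ up (+ (r ℕ.+ suc i)) (N ∸ i)

    length-roots : ∀ {i} → i ℕ.≤ N → length (monicRoots i) ≡ N
    length-roots {i} l = trans (length-++ (down (+ r) i))
      (trans (cong₂ ℕ._+_ (length-down (+ r) i) (length-up (+ (r ℕ.+ suc i)) (N ∸ i))) (ℕ.m+[n∸m]≡n l))

    e-monic : ∀ i j → i ℕ.≤ N → j ℕ.≤ N → e j * A (2 ℕ.* (r ℕ.+ j)) (2 ℕ.* i) ≡ + 2 * leading * ∏ (monicRoots i) (+ j)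
    e-monic i j i≤N j≤N with i ℕ.≤? (r ℕ.+ j)
    -- Both sides vanish: the height 2i exceeds the length 2m, and i > m puts a factor 0 into the
    -- falling factorial.
    ... | no i≰m = trans
      (cong (e j *_) (trans (cong (A (2 ℕ.* m)) (sym beyond)) (A-far (2 ℕ.* m) (2 ℕ.* (i ∸ suc m) ℕ.+ 1))))
      (trans (ℤ.*-zeroʳ (e j)) (sym (trans (cong (+ 2 * leading *_) vanish) (ℤ.*-zeroʳ (+ 2 * leading)))))
      where
      m = r ℕ.+ j
      m<i = ℕ.≰⇒> i≰m
      beyond : 2 ℕ.* m ℕ.+ suc (2 ℕ.* (i ∸ suc m) ℕ.+ 1) ≡ 2 ℕ.* i
      beyond = trans (lemma m (i ∸ suc m)) (cong (2 ℕ.*_) (ℕ.m+[n∸m]≡n m<i))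
        where
        lemma : ∀ m d → 2 ℕ.* m ℕ.+ suc (2 ℕ.* d ℕ.+ 1) ≡ 2 ℕ.* (suc m ℕ.+ d)
        lemma = ℕ-Solver.solve-∀
      vanish : ∏ (monicRoots i) (+ j) ≡ + 0
      vanish = trans (∏-++ (down (+ r) i) _ (+ j))
        (cong (_* ∏ (up (+ (r ℕ.+ suc i)) (N ∸ i)) (+ j)) (∏-down-zero i (cong +_ (ℕ.+-comm j r)) m<i))
    ... | yes i≤m = ℤ.*-cancelʳ-≡ _ _ (fac (2 ℕ.* m)) {{fac≢0 (2 ℕ.* m)}} (begin
      e j * a * fac (2 ℕ.* m)
        ≡⟨ swap (e j) a (fac (2 ℕ.* m)) ⟩
      a * (e j * fac (2 ℕ.* m))
        ≡⟨ cong (a *_) (e-fac j j≤N) ⟩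
      a * (leading * (fac m * fac (m ℕ.+ N)))
        ≡⟨ cong₂ (λ u v → a * (leading * (u * v))) (sym falling) (sym rising) ⟩
      a * (leading * (f * fac p * (g * fac (m ℕ.+ i))))
        ≡⟨ regroup a leading f (fac p) g (fac (m ℕ.+ i)) ⟩
      leading * (f * g) * (a * (fac p * fac (m ℕ.+ i)))
        ≡⟨ cong (λ k → leading * (f * g) * (a * (fac p * fac k))) (sym p+2i) ⟩
      leading * (f * g) * (a * (fac p * fac (p ℕ.+ 2 ℕ.* i)))
        ≡⟨ cong (leading * (f * g) *_) (A-closed (2 ℕ.* m) p (2 ℕ.* i) 2m) ⟩
      leading * (f * g) * (+ 2 * fac (2 ℕ.* m))
        ≡⟨ regroup′ leading (f * g) (fac (2 ℕ.* m)) ⟩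
      + 2 * leading * (f * g) * fac (2 ℕ.* m)
        ≡⟨ cong (λ u → + 2 * leading * u * fac (2 ℕ.* m)) (∏-++ (down (+ r) i) _ (+ j)) ⟨
      + 2 * leading * ∏ (monicRoots i) (+ j) * fac (2 ℕ.* m) ∎)
      where
      m = r ℕ.+ j
      p = m ∸ i
      a = A (2 ℕ.* m) (2 ℕ.* i)
      f = ∏ (down (+ r) i) (+ j)
      g = ∏ (up (+ (r ℕ.+ suc i)) (N ∸ i)) (+ j)
      p+i : p ℕ.+ i ≡ m
      p+i = ℕ.m∸n+n≡m i≤m
      p+2i : p ℕ.+ 2 ℕ.* i ≡ m ℕ.+ i
      p+2i = trans (lemma p i) (cong (ℕ._+ i) p+i)
        where
        lemma : ∀ p i → p ℕ.+ 2 ℕ.* i ≡ p ℕ.+ i ℕ.+ i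
        lemma = ℕ-Solver.solve-∀
      2m : 2 ℕ.* m ≡ 2 ℕ.* p ℕ.+ 2 ℕ.* i
      2m = trans (cong (2 ℕ.*_) (sym p+i)) (ℕ.*-distribˡ-+ 2 p i)
      falling : f * fac p ≡ fac m
      falling = ∏-down i p (cong +_ (ℕ.+-comm j r)) (sym p+i)
      rising : g * fac (m ℕ.+ i) ≡ fac (m ℕ.+ N)
      rising = trans (∏-up (N ∸ i) (m ℕ.+ i) (cong +_ (lemma j r i)))
        (cong fac (trans (ℕ.+-assoc m i (N ∸ i)) (cong (m ℕ.+_) (ℕ.m+[n∸m]≡n i≤N))))
        where
        lemma : ∀ j r i → j ℕ.+ (r ℕ.+ suc i) ≡ suc (r ℕ.+ j ℕ.+ i)
        lemma = ℕ-Solver.solve-∀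
      swap : ∀ e a f → e * a * f ≡ a * (e * f)
      swap = ℤ-Solver.solve-∀
      regroup : ∀ a c f p g q → a * (c * (f * p * (g * q))) ≡ c * (f * g) * (a * (p * q))
      regroup = ℤ-Solver.solve-∀
      regroup′ : ∀ c u f → c * u * (+ 2 * f) ≡ + 2 * c * u * f
      regroup′ = ℤ-Solver.solve-∀

    δ-real : ∀ i → i ℕ.≤ N → δ N (λ j → e j * A (2 ℕ.* (r ℕ.+ j)) (2 ℕ.* i)) 0 ≡ T
    δ-real i l = begin
      δ N (λ j → e j * A (2 ℕ.* (r ℕ.+ j)) (2 ℕ.* i)) 0
        ≡⟨ δ-cong N 0 (λ j → e-monic i j l) ⟩
      δ N (λ j → + 2 * leading * ∏ (monicRoots i) (+ j)) 0
        ≡⟨ δ-scale N 0 (+ 2 * leading) _ ⟩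
      + 2 * leading * δ N (λ j → ∏ (monicRoots i) (+ j)) 0
        ≡⟨ cong (+ 2 * leading *_) (subst (λ k → δ k (λ j → ∏ (monicRoots i) (+ j)) 0 ≡ fac k) (length-roots l) (δ-monic (monicRoots i) 0)) ⟩
      T ∎

    -- The product (2N + 1)(2N - 1)⋯ with k factors, accumulated by k successive differences of
    -- `e₀`.
    coefficient : ℕ → ℤ
    coefficient zero    = + 1
    coefficient (suc k) = coefficient k * (+ 1 + + 2 * (+ N - + k))

    coefficient-odd : ∀ k d → k ℕ.+ d ≡ N → coefficient k * odd 1 d ≡ odd 1 N
    coefficient-odd zero    d refl = ℤ.*-identityˡ _
    coefficient-odd (suc k) d q    = begin
      coefficient k * (+ 1 + + 2 * (+ N - + k)) * odd 1 d
        ≡⟨ cong (λ u → coefficient k * (+ 1 + + 2 * u) * odd 1 d) gap ⟩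
      coefficient k * (+ 1 + + 2 * + suc d) * odd 1 d
        ≡⟨ lemma (coefficient k) (+ 1 + + 2 * + suc d) (odd 1 d) ⟩
      coefficient k * (odd 1 d * (+ 1 + + 2 * + suc d))
        ≡⟨ cong (coefficient k *_) (odd-last 1 d) ⟨
      coefficient k * odd 1 (suc d)
        ≡⟨ coefficient-odd k (suc d) (trans (ℕ.+-suc k d) q) ⟩
      odd 1 N ∎
      where
      gap : + N - + k ≡ + suc d
      gap = trans (cong (λ i → + i - + k) (trans (sym q) (sym (ℕ.+-suc k d)))) (cancel (+ k) (+ suc d))
        where
        cancel : ∀ k d → k + d - k ≡ d
        cancel = ℤ-Solver.solve-∀
      lemma : ∀ c u o → c * u * o ≡ c * (o * u)
      lemma = ℤ-Solver.solve-∀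

    -- Each difference trades one odd factor for a constant: 2 (m + N + 1) - (2 (m + k) + 1) = 2 (N
    -- - k) + 1 does not involve j, so the result is a term of the same kind. The hypothesis keeps
    -- the indices j, ..., j + k at most N, where `N ∸ j` is not truncated.
    δ-e₀ : ∀ k j d → j ℕ.+ k ℕ.+ d ≡ N →
           δ k e₀ j ≡ coefficient k * (two (r ℕ.+ j) * fac (r ℕ.+ j ℕ.+ N) * odd (r ℕ.+ j ℕ.+ k) d)
    δ-e₀ zero j d q = trans (cong₂ (λ a b → two (r ℕ.+ j) * fac (r ℕ.+ j ℕ.+ N) * odd a b) (sym (ℕ.+-identityʳ _)) gap) (sym (ℤ.*-identityˡ _))
      where
      gap : N ∸ j ≡ d
      gap = trans (cong (_∸ j) (sym q)) (trans (cong (λ i → i ℕ.+ d ∸ j) (ℕ.+-identityʳ j)) (ℕ.m+n∸m≡n j d))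
    δ-e₀ (suc k) j d q = begin
      δ k e₀ (suc j) - δ k e₀ j
        ≡⟨ cong₂ _-_ (δ-e₀ k (suc j) d (trans (cong (ℕ._+ d) (sym (ℕ.+-suc j k))) q))
                     (δ-e₀ k j (suc d) (trans (ℕ.+-suc (j ℕ.+ k) d) (trans (cong (ℕ._+ d) (sym (ℕ.+-suc j k))) q))) ⟩
      c * (two (r ℕ.+ suc j) * fac (r ℕ.+ suc j ℕ.+ N) * odd (r ℕ.+ suc j ℕ.+ k) d) - c * (two m * fac (m ℕ.+ N) * odd (m ℕ.+ k) (suc d))
        ≡⟨ cong (λ i → c * (two i * fac (i ℕ.+ N) * odd (i ℕ.+ k) d) - c * (two m * fac (m ℕ.+ N) * odd (m ℕ.+ k) (suc d))) (ℕ.+-suc r j) ⟩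
      c * (two (suc m) * fac (suc (m ℕ.+ N)) * o) - c * (two m * fac (m ℕ.+ N) * ((+ 1 + + 2 * + (m ℕ.+ k)) * o))
        ≡⟨ cong (λ u → c * (two (suc m) * u * o) - c * (two m * fac (m ℕ.+ N) * ((+ 1 + + 2 * + (m ℕ.+ k)) * o))) (fac-suc (m ℕ.+ N)) ⟩
      c * (+ 2 * two m * ((+ 1 + (+ m + + N)) * fac (m ℕ.+ N)) * o) - c * (two m * fac (m ℕ.+ N) * ((+ 1 + + 2 * (+ m + + k)) * o))
        ≡⟨ lemma c (two m) (+ m) (+ N) (fac (m ℕ.+ N)) o (+ k) ⟩
      c * (+ 1 + + 2 * (+ N - + k)) * (two m * fac (m ℕ.+ N) * o)
        ≡⟨ cong (λ i → c * (+ 1 + + 2 * (+ N - + k)) * (two m * fac (m ℕ.+ N) * odd i d)) (ℕ.+-suc m k) ⟨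
      coefficient (suc k) * (two m * fac (m ℕ.+ N) * odd (m ℕ.+ suc k) d) ∎
      where
      m = r ℕ.+ j
      c = coefficient k
      o = odd (suc (m ℕ.+ k)) d
      lemma : ∀ c t m N f o k → c * (+ 2 * t * ((+ 1 + (m + N)) * f) * o) - c * (t * f * ((+ 1 + + 2 * (m + k)) * o)) ≡
              c * (+ 1 + + 2 * (N - k)) * (t * f * o)
      lemma = ℤ-Solver.solve-∀

    δ-infinitesimal : δ N (λ j → e j * E (2 ℕ.* (r ℕ.+ j))) 0 ≡ S
    δ-infinitesimal = begin
      δ N (λ j → e j * E (2 ℕ.* (r ℕ.+ j))) 0
        ≡⟨ δ-cong N 0 rescale ⟩
      δ N (λ j → + 2 * two (r ℕ.+ N) * e₀ j) 0
        ≡⟨ δ-scale N 0 (+ 2 * two (r ℕ.+ N)) e₀ ⟩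
      + 2 * two (r ℕ.+ N) * δ N e₀ 0
        ≡⟨ cong (+ 2 * two (r ℕ.+ N) *_) (δ-e₀ N 0 0 (ℕ.+-identityʳ N)) ⟩
      + 2 * two (r ℕ.+ N) * (coefficient N * (two (r ℕ.+ 0) * fac (r ℕ.+ 0 ℕ.+ N) * + 1))
        ≡⟨ cong₂ (λ u i → + 2 * two (r ℕ.+ N) * (u * (two i * fac (i ℕ.+ N) * + 1)))
             (trans (sym (ℤ.*-identityʳ (coefficient N))) (coefficient-odd N 0 (ℕ.+-identityʳ N))) (ℕ.+-identityʳ r) ⟩
      + 2 * two (r ℕ.+ N) * (odd 1 N * (two r * fac (r ℕ.+ N) * + 1))
        ≡⟨ cong (λ u → + 2 * two (r ℕ.+ N) * (odd 1 N * u)) (ℤ.*-identityʳ (two r * fac (r ℕ.+ N))) ⟩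
      S ∎
      where
      -- Of the two powers 2^m in 4^m, one completes 2^(N - j) to the constant 2^(r + N), and the
      -- other takes its place in `e₀`.
      rescale : ∀ j → j ℕ.≤ N → e j * E (2 ℕ.* (r ℕ.+ j)) ≡ + 2 * two (r ℕ.+ N) * e₀ j
      rescale j l = begin
        e j * E (2 ℕ.* m)
          ≡⟨ cong (e j *_) (trans (E-even m) (cong (+ 2 *_) (four m))) ⟩
        e j * (+ 2 * (two m * two m))
          ≡⟨ lemma (two d) (fac (m ℕ.+ N)) (odd m d) (two m) ⟩
        + 2 * (two m * two d) * e₀ j
          ≡⟨ cong (λ u → + 2 * u * e₀ j) (trans (sym (two-+ m d)) (cong two (sum-gap l))) ⟩
        + 2 * two (r ℕ.+ N) * e₀ j ∎
        where
        m = r ℕ.+ j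
        d = N ∸ j
        lemma : ∀ a x o b → a * x * o * (+ 2 * (b * b)) ≡ + 2 * (b * a) * (b * x * o)
        lemma = ℤ-Solver.solve-∀

    T-nonZero : ℤ.NonZero T
    T-nonZero = ℤ.i*j≢0 (+ 2 * leading) (fac N)
      {{ℤ.i*j≢0 (+ 2) leading {{_}} {{ℤ.i*j≢0 (two (r ℕ.+ N)) (odd 0 (r ℕ.+ N)) {{two-nonZero (r ℕ.+ N)}} {{odd-nonZero 0 (r ℕ.+ N)}}}}}} {{fac≢0 N}}

    e-nonZero : ℤ.NonZero (e 0)
    e-nonZero = ℤ.i*j≢0 (two N * fac (r ℕ.+ 0 ℕ.+ N)) (odd (r ℕ.+ 0) N)
      {{ℤ.i*j≢0 (two N) (fac (r ℕ.+ 0 ℕ.+ N)) {{two-nonZero N}} {{fac≢0 (r ℕ.+ 0 ℕ.+ N)}}}} {{odd-nonZero (r ℕ.+ 0) N}}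

-- The linear equation for the mean number of contacts.

module MeanEquation where
  open DualNumbers
  open Determinants
  open Families
  open WeightedWalks
  open CriticalWeight
  open FiniteDifferences
  import Tactic.RingSolver as Solver
  open import Data.Nat as ℕ using (ℕ; zero; suc)
  import Data.Nat.Properties as ℕ
  open import Data.Integer as ℤ using (ℤ; +_; -[1+_])
  import Data.Integer.Properties as ℤ
  import Data.Integer.Tactic.RingSolver as ℤ-Solver
  open import Data.Fin using (zero; toℕ)
  import Data.Fin.Properties as Fin
  open import Data.List using (applyUpTo; allFin)
  open import Data.Product using (∃; _×_; proj₁; proj₂)
  open import Function using (_∘_)
  open import Relation.Binary.PropositionalEquality
  open ≡-Reasoning

  open Weighted κ using (value)

  Δ-parts : ∀ k j f → Δ k f j ≡ δ k (re ∘ f) j +ε δ k (ep ∘ f) j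
  Δ-parts zero j f with f j
  ... | a +ε b = refl
  Δ-parts (suc k) j f = cong₂ _-_ (Δ-parts k (suc j) f) (Δ-parts k j f)

  real-pow : ∀ t n → (t +ε + 0) ^ᵈ n ≡ t ℤ.^ n +ε + 0
  real-pow t zero    = refl
  real-pow t (suc n) = trans (cong ((t +ε + 0) *_) (real-pow t n)) (cong (t ℤ.* t ℤ.^ n +ε_) (lemma t))
    where
    lemma : ∀ t → t ℤ.* + 0 ℤ.+ + 0 ℤ.* t ℤ.^ n ≡ + 0
    lemma t = cong (ℤ._+ + 0) (ℤ.*-zeroʳ t)

  -- Since κ (1 + ε) = 2 (1 + 2ε), the two powers together shift the logarithmic derivative by 2N.
  normalisation : ∀ N → κ ^ᵈ N * (+ 1 +ε + 1) ^ᵈ N ≡ two N +ε + 2 ℤ.* + N ℤ.* two N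
  normalisation zero    = refl
  normalisation (suc N) = begin
    κ * κ ^ᵈ N * ((+ 1 +ε + 1) * (+ 1 +ε + 1) ^ᵈ N)
      ≡⟨ regroup κ (κ ^ᵈ N) (+ 1 +ε + 1) ((+ 1 +ε + 1) ^ᵈ N) ⟩
    (+ 2 +ε + 4) * (κ ^ᵈ N * (+ 1 +ε + 1) ^ᵈ N)
      ≡⟨ cong ((+ 2 +ε + 4) *_) (normalisation N) ⟩
    (+ 2 +ε + 4) * (two N +ε + 2 ℤ.* + N ℤ.* two N)
      ≡⟨ cong (+ 2 ℤ.* two N +ε_) (lemma (+ N) (two N)) ⟩
    two (suc N) +ε + 2 ℤ.* + suc N ℤ.* two (suc N) ∎
    where
    regroup : ∀ k p a q → k * p * (a * q) ≡ (k * a) * (p * q)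
    regroup = Solver.solve-∀ solverRing
    lemma : ∀ n t → + 2 ℤ.* (+ 2 ℤ.* n ℤ.* t) ℤ.+ + 4 ℤ.* t ≡ + 2 ℤ.* (+ 1 ℤ.+ n) ℤ.* (+ 2 ℤ.* t)
    lemma = ℤ-Solver.solve-∀

  -- Eliminating d between the real and infinitesimal parts.
  ratio-of-parts : ∀ u s e p n z k t σ d → ℤ.NonZero (u ℤ.* (s ℤ.* e) ℤ.* p) →
    (u +ε + 0) * ((s +ε + 0) * (e +ε + 0) * ((p +ε + 2 ℤ.* n ℤ.* p) * (z +ε k)))
      ≡ (u +ε + 0) * ((t +ε σ) * (d +ε + 0)) →
    (k ℤ.+ + 2 ℤ.* n ℤ.* z) ℤ.* t ≡ σ ℤ.* z
  ratio-of-parts u s e p n z k t σ d nz parts = ℤ.*-cancelʳ-≡ _ _ h {{nz}} (begin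
    (k ℤ.+ + 2 ℤ.* n ℤ.* z) ℤ.* t ℤ.* h
      ≡⟨ swap (k ℤ.+ + 2 ℤ.* n ℤ.* z) t h ⟩
    t ℤ.* (h ℤ.* (k ℤ.+ + 2 ℤ.* n ℤ.* z))
      ≡⟨ cong (t ℤ.*_) (trans (ep-left u s e p n z k) (trans (cong ep parts) (ep-right u t σ d))) ⟩
    t ℤ.* (u ℤ.* σ ℤ.* d)
      ≡⟨ exchange t u σ d ⟩
    σ ℤ.* (u ℤ.* (t ℤ.* d))
      ≡⟨ cong (σ ℤ.*_) (cong re parts) ⟨
    σ ℤ.* (u ℤ.* (s ℤ.* e ℤ.* (p ℤ.* z)))
      ≡⟨ collect σ u s e p z ⟩
    σ ℤ.* z ℤ.* h ∎)
    where
    h = u ℤ.* (s ℤ.* e) ℤ.* p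
    swap : ∀ m t h → m ℤ.* t ℤ.* h ≡ t ℤ.* (h ℤ.* m)
    swap = ℤ-Solver.solve-∀
    ep-left : ∀ u s e p n z k →
      u ℤ.* (s ℤ.* e) ℤ.* p ℤ.* (k ℤ.+ + 2 ℤ.* n ℤ.* z) ≡
      u ℤ.* (s ℤ.* e ℤ.* (p ℤ.* k ℤ.+ + 2 ℤ.* n ℤ.* p ℤ.* z) ℤ.+ (s ℤ.* + 0 ℤ.+ + 0 ℤ.* e) ℤ.* (p ℤ.* z))
        ℤ.+ + 0 ℤ.* (s ℤ.* e ℤ.* (p ℤ.* z))
    ep-left = ℤ-Solver.solve-∀
    ep-right : ∀ u t s d → u ℤ.* (t ℤ.* + 0 ℤ.+ s ℤ.* d) ℤ.+ + 0 ℤ.* (t ℤ.* d) ≡ u ℤ.* s ℤ.* d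
    ep-right = ℤ-Solver.solve-∀
    exchange : ∀ t u s d → t ℤ.* (u ℤ.* s ℤ.* d) ≡ s ℤ.* (u ℤ.* (t ℤ.* d))
    exchange = ℤ-Solver.solve-∀
    collect : ∀ S u s e p z → S ℤ.* (u ℤ.* (s ℤ.* e ℤ.* (p ℤ.* z))) ≡ S ℤ.* z ℤ.* (u ℤ.* (s ℤ.* e) ℤ.* p)
    collect = ℤ-Solver.solve-∀

  module _ (N r : ℕ) where
    open Coefficients N r
    open Contraction

    private
      D : Dual
      D = det (applyUpTo (column N r) (suc N)) (allFin (suc N))

    combination : ∀ i → Δ N (λ j → (e j +ε + 0) * column N r j i) 0 ≡ T +ε S
    combination i = trans (Δ-parts N 0 (λ j → (e j +ε + 0) * column N r j i)) (cong₂ _+ε_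
      (trans (δ-cong N 0 (λ j _ → cong (λ m → e j ℤ.* A m (2 ℕ.* toℕ i)) (sym (ℕ.*-distribˡ-+ 2 r j)))) (δ-real (toℕ i) (Fin.toℕ≤pred[n] i)))
      (trans (δ-cong N 0 (λ j _ → trans (ℤ.+-identityʳ _) (cong (λ m → e j ℤ.* E m) (sym (ℕ.*-distribˡ-+ 2 r j))))) δ-infinitesimal))

    -- As ε² = 0, adding -ε b (T + ε S) to T (a + ε b) removes exactly the infinitesimal part.
    shifted : ∀ j i → (T +ε + 0) * (re (column N r j i) +ε + 0) ≡
              (T +ε + 0) * column N r j i + (+ 0 +ε ℤ.- ep (column N r j i)) * (T +ε S)
    shifted j i = cong₂ _+ε_ (re-part T a) (ep-part T a b S)
      where
      a = re (column N r j i)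
      b = ep (column N r j i)
      re-part : ∀ t a → t ℤ.* a ≡ t ℤ.* a ℤ.+ + 0 ℤ.* t
      re-part = ℤ-Solver.solve-∀
      ep-part : ∀ t a b s → t ℤ.* + 0 ℤ.+ + 0 ℤ.* a ≡ (t ℤ.* b ℤ.+ + 0 ℤ.* a) ℤ.+ (+ 0 ℤ.* s ℤ.+ ℤ.- b ℤ.* t)
      ep-part = ℤ-Solver.solve-∀

    private
      factored : ∃ λ x → Real x × (T +ε + 0) ^ᵈ N * ((- 1#) ^ᵈ N * (e 0 +ε + 0) * D) ≡ (T +ε + 0) ^ᵈ N * ((T +ε S) * x)
      factored = ColumnOperations.det-with-constant-combination {φ = column N r} {χ = λ j i → re (column N r j i) +ε + 0}
        -- One multiple is needed per column; row `zero` may stand for all rows because the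
        -- infinitesimal part of `column` is independent of the row.
        {e = λ j → e j +ε + 0} N (T +ε + 0) (T +ε S) (λ j → + 0 +ε ℤ.- ep (column N r j zero))
        combination shifted (λ j i → real _) (allFin (suc N))

      u h : ℤ
      u = T ℤ.^ N
      h = u ℤ.* ((-[1+ 0 ] ℤ.^ N) ℤ.* e 0)

      h-nonZero : ℤ.NonZero (h ℤ.* two N)
      h-nonZero = ℤ.i*j≢0 h (two N)
        {{ℤ.i*j≢0 u (-[1+ 0 ] ℤ.^ N ℤ.* e 0) {{pow-nonZero T N T-nonZero}}
          {{ℤ.i*j≢0 (-[1+ 0 ] ℤ.^ N) (e 0) {{pow-nonZero -[1+ 0 ] N _}} {{e-nonZero}}}}}}
        {{two-nonZero N}}

    mean-equation : ∀ {z k} → ∑ (allFamilies (suc N) (2 ℕ.* r)) (value (start 0 (suc N))) ≡ z +ε k →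
                    (k ℤ.+ + 2 ℤ.* + N ℤ.* z) ℤ.* T ≡ S ℤ.* z
    mean-equation {z} {k} W≡ = conclude (proj₁ (proj₂ factored)) (proj₂ (proj₂ factored))
      where
      s = -[1+ 0 ] ℤ.^ N
      count : (two N +ε + 2 ℤ.* + N ℤ.* two N) * (z +ε k) ≡ D
      count = trans (cong₂ _*_ (sym (normalisation N)) (sym W≡)) (reduced-count N r)
      conclude : ∀ {x} → Real x → (T +ε + 0) ^ᵈ N * ((- 1#) ^ᵈ N * (e 0 +ε + 0) * D) ≡ (T +ε + 0) ^ᵈ N * ((T +ε S) * x) →
                 (k ℤ.+ + 2 ℤ.* + N ℤ.* z) ℤ.* T ≡ S ℤ.* z
      conclude (real d) q = ratio-of-parts u s (e 0) (two N) (+ N) z k T S d h-nonZero (begin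
        (u +ε + 0) * ((s +ε + 0) * (e 0 +ε + 0) * ((two N +ε + 2 ℤ.* + N ℤ.* two N) * (z +ε k)))
          ≡⟨ cong₂ (λ v w → v * (w * (e 0 +ε + 0) * ((two N +ε + 2 ℤ.* + N ℤ.* two N) * (z +ε k)))) (real-pow T N) (real-pow -[1+ 0 ] N) ⟨
        (T +ε + 0) ^ᵈ N * ((- 1#) ^ᵈ N * (e 0 +ε + 0) * ((two N +ε + 2 ℤ.* + N ℤ.* two N) * (z +ε k)))
          ≡⟨ cong (λ v → (T +ε + 0) ^ᵈ N * ((- 1#) ^ᵈ N * (e 0 +ε + 0) * v)) count ⟩
        (T +ε + 0) ^ᵈ N * ((- 1#) ^ᵈ N * (e 0 +ε + 0) * D)
          ≡⟨ q ⟩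
        (T +ε + 0) ^ᵈ N * ((T +ε S) * x)
          ≡⟨ cong (_* ((T +ε S) * x)) (real-pow T N) ⟩
        (u +ε + 0) * ((T +ε S) * x) ∎)
        where x = d +ε + 0

-- The partition function as a dual number, and its positivity.

module PartitionFunction where
  open DualNumbers
  open Families
  open WeightedWalks
  open CriticalWeight using (κ)
  open import Data.Bool using (Bool; true; false; _∧_; if_then_else_; T)
  open import Data.Nat as ℕ using (ℕ; zero; suc)
  import Data.Nat.Properties as ℕ
  import Data.Nat.Tactic.RingSolver as ℕ-Solver
  open import Data.Integer as ℤ using (ℤ; +_)
  import Data.Integer.Properties as ℤ
  import Data.Integer.Tactic.RingSolver as ℤ-Solver
  open import Data.List using ([]; _∷_; map; filter)
  open import Data.List.Membership.Propositional using (_∈_; lose)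
  open import Data.List.Membership.Propositional.Properties using (∈-concatMap⁺; ∈-map⁺; ∈-filter⁺)
  open import Data.List.Relation.Unary.Any using (here; there)
  open import Data.Nat.ListAction using (sum)
  open import Data.Vec using (Vec; []; _∷_; replicate)
  open import Data.Product using (∃; _,_)
  open import Relation.Nullary using (T?)
  open import Relation.Binary.PropositionalEquality

  open Weighted κ

  familyHeights-paths : ∀ k {n t} (f : Vec (Vec Step t) n) → familyHeights k f ≡ paths (start k n) f
  familyHeights-paths k []      = refl
  familyHeights-paths k (s ∷ f) = cong (heights (+ (2 ℕ.* k)) s ∷_) (familyHeights-paths (suc k) f)

  κ-power : ∀ c → κ ^ᵈ c ≡ + (2 ℕ.^ c) +ε + (c ℕ.* 2 ℕ.^ c)
  κ-power zero    = refl
  κ-power (suc c) = trans (cong (κ *_) (κ-power c)) (cong₂ _+ε_ (sym (ℤ.pos-* 2 p))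
    (trans (cong₂ ℤ._+_ (sym (ℤ.pos-* 2 (c ℕ.* p))) (sym (ℤ.pos-* 2 p))) (cong +_ (lemma c p))))
    where
    p = 2 ℕ.^ c
    lemma : ∀ c p → 2 ℕ.* (c ℕ.* p) ℕ.+ 2 ℕ.* p ≡ suc c ℕ.* (2 ℕ.* p)
    lemma = ℕ-Solver.solve-∀

  value-isVicious : ∀ {n t} (f : Vec (Vec Step t) n) →
    value (start 0 n) f ≡ (if isVicious 0 f then + (2 ℕ.^ contacts f) +ε + (contacts f ℕ.* 2 ℕ.^ contacts f) else 0#)
  value-isVicious f rewrite familyHeights-paths 0 f =
    cong (λ v → if vicious (start 0 _) f then v else 0#) (κ-power (touches (start 0 _) f))

  ∑-filter : ∀ {X : Set} (P : X → Bool) (a b : X → ℕ) xs →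
    ∑ xs (λ x → if P x then + a x +ε + b x else 0#)
    ≡ + sum (map a (filter (λ x → T? (P x)) xs)) +ε + sum (map b (filter (λ x → T? (P x)) xs))
  ∑-filter P a b []       = refl
  ∑-filter P a b (x ∷ xs) with P x
  ... | true  = cong (λ v → (+ a x +ε + b x) + v) (∑-filter P a b xs)
  ... | false = trans (+-identityˡ _) (∑-filter P a b xs)

  partition-function : ∀ n t → ∑ (allFamilies n t) (value (start 0 n)) ≡ + Z n t 0 2 +ε + κdZ n t 0 2
  partition-function n t = trans (∑-cong (allFamilies n t) value-isVicious)
    (∑-filter (isVicious 0) (λ f → 2 ℕ.^ contacts f) (λ f → contacts f ℕ.* 2 ℕ.^ contacts f) (allFamilies n t))

  ∈-allSteps : ∀ {t} (s : Vec Step t) → s ∈ allSteps t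
  ∈-allSteps []          = here refl
  ∈-allSteps (true ∷ s)  = ∈-concatMap⁺ _ (lose (∈-allSteps s) (here refl))
  ∈-allSteps (false ∷ s) = ∈-concatMap⁺ _ (lose (∈-allSteps s) (there (here refl)))

  ∈-allFamilies : ∀ {n t} (f : Vec (Vec Step t) n) → f ∈ allFamilies n t
  ∈-allFamilies []      = here refl
  ∈-allFamilies (s ∷ f) = ∈-concatMap⁺ _ (lose (∈-allFamilies f) (∈-map⁺ (_∷ f) (∈-allSteps s)))

  ∈⇒≤sum : ∀ {X : Set} (a : X → ℕ) {x xs} → x ∈ xs → a x ℕ.≤ sum (map a xs)
  ∈⇒≤sum a (here refl)          = ℕ.m≤m+n _ _
  ∈⇒≤sum a (there {x = y} x∈xs) = ℕ.≤-trans (∈⇒≤sum a x∈xs) (ℕ.m≤n+m _ (a y))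

  ups downs : ∀ n → Vec Step n
  ups n   = replicate n true
  downs n = replicate n false

  ups-strict : ∀ {n} {xs : Vec ℤ n} → Chain 1 xs → Chain 1 (move xs (ups n))
  ups-strict []  = []
  ups-strict [-] = [-]
  ups-strict {xs = x ∷ _} ((d , refl) ∷ ch) = (d , lemma x (+ suc d)) ∷ ups-strict ch
    where
    lemma : ∀ x d → x ℤ.+ + 2 ℤ.* d ℤ.+ + 1 ≡ x ℤ.+ + 1 ℤ.+ + 2 ℤ.* d
    lemma = ℤ-Solver.solve-∀

  start-nonneg : ∀ k n → allNonneg (start k n) ≡ true
  start-nonneg k zero    = refl
  start-nonneg k (suc n) = start-nonneg (suc k) n

  ups-nonneg : ∀ k n → allNonneg (move (start k n) (ups n)) ≡ true
  ups-nonneg k zero    = refl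
  ups-nonneg k (suc n) = ups-nonneg (suc k) n

  ups-downs : ∀ {n} (xs : Vec ℤ n) → move (move xs (ups n)) (downs n) ≡ xs
  ups-downs []       = refl
  ups-downs (x ∷ xs) = cong₂ _∷_ (lemma x) (ups-downs xs)
    where
    lemma : ∀ x → x ℤ.+ + 1 ℤ.- + 1 ≡ x
    lemma = ℤ-Solver.solve-∀

  -- All walks alternate up and down in parallel, which keeps the gaps constant. This witness makes
  -- the denominator of the mean nonzero.
  zigzag : ∀ n r → ∃ λ (f : Vec (Vec Step (2 ℕ.* r)) n) → vicious (start 0 n) f ≡ true
  zigzag n zero = stay n , cong₂ _∧_ (valid-start 0 n)
    (trans (pairwiseDisjoint-stay (start 0 n)) (strict⇒distinct (packed-strict 0 n)))
  zigzag n (suc r) with zigzag n r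
  ... | f , v = subst (λ t → ∃ λ (f : Vec (Vec Step t) n) → vicious (start 0 n) f ≡ true) (sym (ℕ.*-suc 2 r))
    (prepend (ups n) (prepend (downs n) f) ,
     trans (vicious-prepend (start 0 n) (ups n) (prepend (downs n) f))
       (cong₂ _∧_ (cong₂ _∧_ (start-nonneg 0 n) (strict⇒distinct (packed-strict 0 n)))
         (trans (vicious-prepend (move (start 0 n) (ups n)) (downs n) f)
           (cong₂ _∧_ (cong₂ _∧_ (ups-nonneg 0 n) (strict⇒distinct (ups-strict (packed-strict 0 n))))
             (trans (cong (λ xs → vicious xs f) (ups-downs (start 0 n))) v)))))

  Z-positive : ∀ n r → 0 ℕ.< Z n (2 ℕ.* r) 0 2
  Z-positive n r with zigzag n r
  ... | f , v = ℕ.<-≤-trans (ℕ.m^n>0 2 (contacts f)) (∈⇒≤sum (λ f → 2 ℕ.^ contacts f)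
    (∈-filter⁺ (λ f → T? (isVicious 0 f)) (∈-allFamilies f) (subst T (sym v′) _)))
    where
    v′ : isVicious 0 f ≡ true
    v′ rewrite familyHeights-paths 0 f = v

-- Central binomial coefficients and the closed form.

module ClosedForm where
  open FiniteDifferences
  open MeanEquation using (mean-equation)
  open PartitionFunction using (partition-function)
  open import Data.Nat as ℕ using (ℕ; zero; suc; _+_; _*_; _^_; _∸_; _!; s≤s; z≤n)
  import Data.Nat.Properties as ℕ
  import Data.Nat.DivMod as ℕ
  open import Data.Nat.Combinatorics using (_C_; nCk≡n!/k![n-k]!; k![n∸k]!∣n!)
  open import Data.Integer as ℤ using (+_)
  import Data.Integer.Properties as ℤ
  import Data.Integer.Tactic.RingSolver as ℤ-Solver
  open import Data.Rational as ℚ using (_-_)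
  import Data.Rational.Properties as ℚ
  open import Data.Rational.Unnormalised using (mkℚᵘ; *≡*)
  import Data.Rational.Unnormalised.Properties as ℚᵘ
  open import Relation.Binary.PropositionalEquality

  central-binomial : ∀ m → ((2 * m) C m) * (m ! * m !) ≡ (2 * m) !
  central-binomial m = begin
    ((2 * m) C m) * (m ! * m !)
      ≡⟨ cong (λ k → ((2 * m) C m) * (m ! * k !)) gap ⟨
    ((2 * m) C m) * (m ! * (2 * m ∸ m) !)
      ≡⟨ cong (_* (m ! * (2 * m ∸ m) !)) (nCk≡n!/k![n-k]! m≤2m) ⟩
    ((2 * m) ! ℕ./ (m ! * (2 * m ∸ m) !)) {{nz}} * (m ! * (2 * m ∸ m) !)
      ≡⟨ ℕ.m/n*n≡m {{nz}} (k![n∸k]!∣n! m≤2m) ⟩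
    (2 * m) ! ∎
    where
    open ≡-Reasoning
    nz = m ℕ.!* (2 * m ∸ m) !≢0
    m≤2m : m ℕ.≤ 2 * m
    m≤2m = ℕ.m≤m+n m (m + 0)
    gap : 2 * m ∸ m ≡ m
    gap = trans (ℕ.m+n∸m≡n m (m + 0)) (ℕ.+-identityʳ m)

  open ≡-Reasoning

  central-binomial-odd : ∀ m → + ((2 * m) C m) ℤ.* fac m ≡ two m ℤ.* odd 0 m
  central-binomial-odd m = ℤ.*-cancelʳ-≡ _ _ (fac m) {{fac≢0 m}} (begin
    + c ℤ.* fac m ℤ.* fac m       ≡⟨ ℤ.*-assoc (+ c) (fac m) (fac m) ⟩
    + c ℤ.* (fac m ℤ.* fac m)     ≡⟨ cong (+ c ℤ.*_) (ℤ.pos-* (m !) (m !)) ⟨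
    + c ℤ.* + (m ! * m !)         ≡⟨ ℤ.pos-* c (m ! * m !) ⟨
    + (c * (m ! * m !))           ≡⟨ cong +_ (central-binomial m) ⟩
    fac (2 * m)                   ≡⟨ fac-double m ⟩
    two m ℤ.* fac m ℤ.* odd 0 m   ≡⟨ lemma (two m) (fac m) (odd 0 m) ⟩
    two m ℤ.* odd 0 m ℤ.* fac m   ∎)
    where
    c = (2 * m) C m
    lemma : ∀ t f o → t ℤ.* f ℤ.* o ≡ t ℤ.* o ℤ.* f
    lemma = ℤ-Solver.solve-∀

  two-pos : ∀ n → + (2 ^ n) ≡ two n
  two-pos zero    = refl
  two-pos (suc n) = trans (ℤ.pos-* 2 (2 ^ n)) (cong (+ 2 ℤ.*_) (two-pos n))

  -- Positivity of z and y keeps `_÷ℕ_` away from its default value 0; the identity is then verified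
  -- by cross-multiplying unnormalised fractions.
  ÷-difference : ∀ k z x y c → 0 ℕ.< z → 0 ℕ.< y → (+ k ℤ.+ + c ℤ.* + z) ℤ.* + y ≡ + x ℤ.* + z →
                 (+ k) ÷ℕ z ≡ ((+ x) ÷ℕ y) - (+ c) ÷ℕ 1
  ÷-difference k (suc z) x (suc y) c _ _ eq = ℚ.toℚᵘ-injective (ℚᵘ.≃-trans (ℚ.toℚᵘ-fromℚᵘ (mkℚᵘ (+ k) z))
    (ℚᵘ.≃-trans (*≡* cross) (ℚᵘ.≃-sym
      (ℚᵘ.≃-trans (ℚ.toℚᵘ-homo-+ (+ x ℚ./ suc y) (ℚ.- (+ c ℚ./ 1)))
        (ℚᵘ.+-cong (ℚ.toℚᵘ-fromℚᵘ (mkℚᵘ (+ x) y))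
          (ℚᵘ.≃-trans (ℚ.toℚᵘ-homo‿- (+ c ℚ./ 1)) (ℚᵘ.-‿cong (ℚ.toℚᵘ-fromℚᵘ (mkℚᵘ (+ c) 0)))))))))
    where
    cross : + k ℤ.* (+ (suc y * 1)) ≡ (+ x ℤ.* + 1 ℤ.+ (ℤ.- + c) ℤ.* + suc y) ℤ.* + suc z
    cross = begin
      + k ℤ.* + (suc y * 1)
        ≡⟨ cong (λ i → + k ℤ.* + i) (ℕ.*-identityʳ (suc y)) ⟩
      + k ℤ.* + suc y
        ≡⟨ lemma (+ k) (+ c) (+ suc z) (+ suc y) ⟩
      (+ k ℤ.+ + c ℤ.* + suc z) ℤ.* + suc y ℤ.+ (ℤ.- + c) ℤ.* + suc y ℤ.* + suc z
        ≡⟨ cong (ℤ._+ (ℤ.- + c) ℤ.* + suc y ℤ.* + suc z) eq ⟩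
      + x ℤ.* + suc z ℤ.+ (ℤ.- + c) ℤ.* + suc y ℤ.* + suc z
        ≡⟨ lemma′ (+ x) (ℤ.- + c) (+ suc z) (+ suc y) ⟩
      (+ x ℤ.* + 1 ℤ.+ (ℤ.- + c) ℤ.* + suc y) ℤ.* + suc z ∎
      where
      lemma : ∀ k c z y → k ℤ.* y ≡ (k ℤ.+ c ℤ.* z) ℤ.* y ℤ.+ (ℤ.- c) ℤ.* y ℤ.* z
      lemma = ℤ-Solver.solve-∀
      lemma′ : ∀ x c z y → x ℤ.* z ℤ.+ c ℤ.* y ℤ.* z ≡ (x ℤ.* + 1 ℤ.+ c ℤ.* y) ℤ.* z
      lemma′ = ℤ-Solver.solve-∀

  module _ (N r : ℕ) where
    open Coefficients N r

    private
      -- The 1/2 in 2^(2r - 1) is carried by Y as a factor 2, since that exponent is negative at r =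
      -- 0.
      p n X Y : ℕ
      p = r + N
      n = suc N
      X = 2 ^ (2 * r) * n * ((2 * n) C n)
      Y = 2 * ((2 * p) C p)

    -- `central-binomial-odd` turns both binomials into double factorials: (2p - 1)!! is the one in
    -- T, and (2n - 1)!! = 3 · 5 ⋯ (2N + 1) the one in S.
    closed-ratio : S ℤ.* + Y ≡ + X ℤ.* T
    closed-ratio = ℤ.*-cancelʳ-≡ _ _ (fac p ℤ.* fac n) {{ℤ.i*j≢0 (fac p) (fac n) {{fac≢0 p}} {{fac≢0 n}}}} (begin
      S ℤ.* + Y ℤ.* (fac p ℤ.* fac n)
        ≡⟨ cong (λ y → S ℤ.* y ℤ.* (fac p ℤ.* fac n)) (ℤ.pos-* 2 ((2 * p) C p)) ⟩
      S ℤ.* (+ 2 ℤ.* b) ℤ.* (fac p ℤ.* fac n)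
        ≡⟨ regroup (two p) (odd 1 N) (two r) (fac p) b (fac n) ⟩
      + 4 ℤ.* two p ℤ.* odd 1 N ℤ.* two r ℤ.* fac p ℤ.* fac n ℤ.* (b ℤ.* fac p)
        ≡⟨ cong₂ (λ u v → + 4 ℤ.* two p ℤ.* odd 1 N ℤ.* two r ℤ.* fac p ℤ.* u ℤ.* v) (fac-suc N) (central-binomial-odd p) ⟩
      + 4 ℤ.* two p ℤ.* odd 1 N ℤ.* two r ℤ.* fac p ℤ.* (+ n ℤ.* fac N) ℤ.* (two p ℤ.* odd 0 p)
        ≡⟨ cong (λ u → + 4 ℤ.* two p ℤ.* odd 1 N ℤ.* two r ℤ.* fac p ℤ.* (+ n ℤ.* fac N) ℤ.* (u ℤ.* odd 0 p)) (two-+ r N) ⟩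
      + 4 ℤ.* two p ℤ.* odd 1 N ℤ.* two r ℤ.* fac p ℤ.* (+ n ℤ.* fac N) ℤ.* (two r ℤ.* two N ℤ.* odd 0 p)
        ≡⟨ exchange (two p) (odd 1 N) (two r) (fac p) (+ n) (fac N) (two N) (odd 0 p) ⟩
      (two r ℤ.* two r) ℤ.* + n ℤ.* T ℤ.* fac p ℤ.* (two n ℤ.* odd 0 n)
        ≡⟨ cong (λ u → (two r ℤ.* two r) ℤ.* + n ℤ.* T ℤ.* fac p ℤ.* u) (central-binomial-odd n) ⟨
      (two r ℤ.* two r) ℤ.* + n ℤ.* T ℤ.* fac p ℤ.* (a ℤ.* fac n)
        ≡⟨ regroup′ (two r ℤ.* two r) (+ n) T (fac p) a (fac n) ⟩
      (two r ℤ.* two r) ℤ.* + n ℤ.* a ℤ.* T ℤ.* (fac p ℤ.* fac n)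
        ≡⟨ cong (λ u → u ℤ.* T ℤ.* (fac p ℤ.* fac n)) X≡ ⟨
      + X ℤ.* T ℤ.* (fac p ℤ.* fac n) ∎)
      where
      a = + ((2 * n) C n)
      b = + ((2 * p) C p)
      X≡ : + X ≡ (two r ℤ.* two r) ℤ.* + n ℤ.* a
      X≡ = trans (ℤ.pos-* (2 ^ (2 * r) * n) ((2 * n) C n)) (cong (ℤ._* a) (trans (ℤ.pos-* (2 ^ (2 * r)) n)
        (cong (ℤ._* + n) (trans (two-pos (2 * r)) (trans (cong two (cong (λ i → r + i) (ℕ.+-identityʳ r))) (two-+ r r))))))
      regroup : ∀ t o s f b g → + 2 ℤ.* t ℤ.* (o ℤ.* (s ℤ.* f)) ℤ.* (+ 2 ℤ.* b) ℤ.* (f ℤ.* g) ≡ + 4 ℤ.* t ℤ.* o ℤ.* s ℤ.* f ℤ.* g ℤ.* (b ℤ.* f)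
      regroup = ℤ-Solver.solve-∀
      regroup′ : ∀ s n t f a g → s ℤ.* n ℤ.* t ℤ.* f ℤ.* (a ℤ.* g) ≡ s ℤ.* n ℤ.* a ℤ.* t ℤ.* (f ℤ.* g)
      regroup′ = ℤ-Solver.solve-∀
      exchange : ∀ t o s f n g u q → + 4 ℤ.* t ℤ.* o ℤ.* s ℤ.* f ℤ.* (n ℤ.* g) ℤ.* (s ℤ.* u ℤ.* q) ≡
        (s ℤ.* s) ℤ.* n ℤ.* (+ 2 ℤ.* (t ℤ.* q) ℤ.* g) ℤ.* f ℤ.* ((+ 2 ℤ.* u) ℤ.* ((+ 1 ℤ.+ + 2 ℤ.* + 0) ℤ.* o))
      exchange = ℤ-Solver.solve-∀

    Y-positive : 0 ℕ.< Y
    Y-positive = ℕ.*-mono-< {0} {2} {0} {(2 * p) C p} (s≤s z≤n) (ℕ.n≢0⇒n>0 λ b≡0 →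
      ℕ.m<n⇒n≢0 (ℕ.1≤n! (2 * p)) (trans (sym (central-binomial p)) (cong (_* (p ! * p !)) b≡0)))

    mean-cross : (+ κdZ n (2 * r) 0 2 ℤ.+ + (2 * N) ℤ.* + Z n (2 * r) 0 2) ℤ.* + Y ≡ + X ℤ.* + Z n (2 * r) 0 2
    mean-cross = ℤ.*-cancelʳ-≡ _ _ T {{T-nonZero}} (begin
      m ℤ.* + Y ℤ.* T
        ≡⟨ swap m (+ Y) T ⟩
      m ℤ.* T ℤ.* + Y
        ≡⟨ cong (λ u → (+ κdZ n (2 * r) 0 2 ℤ.+ u ℤ.* z) ℤ.* T ℤ.* + Y) (ℤ.pos-* 2 N) ⟩
      (+ κdZ n (2 * r) 0 2 ℤ.+ + 2 ℤ.* + N ℤ.* z) ℤ.* T ℤ.* + Y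
        ≡⟨ cong (ℤ._* + Y) (mean-equation N r (partition-function n (2 * r))) ⟩
      S ℤ.* z ℤ.* + Y
        ≡⟨ swap S z (+ Y) ⟩
      S ℤ.* + Y ℤ.* z
        ≡⟨ cong (ℤ._* z) closed-ratio ⟩
      + X ℤ.* T ℤ.* z
        ≡⟨ swap (+ X) T z ⟩
      + X ℤ.* z ℤ.* T ∎)
      where
      z = + Z n (2 * r) 0 2
      m = + κdZ n (2 * r) 0 2 ℤ.+ + (2 * N) ℤ.* z
      swap : ∀ a b c → a ℤ.* b ℤ.* c ≡ a ℤ.* c ℤ.* b
      swap = ℤ-Solver.solve-∀

open import Data.Nat using (ℕ; suc; _+_; _*_; _^_; _≥_; _∸_)
import Data.Nat.Properties as ℕ
import Data.Nat.Tactic.RingSolver as ℕ-Solver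
open import Data.Nat.Combinatorics using (_C_)
open import Data.Integer using (+_)
open import Data.Rational using (ℚ; _-_)
open import Relation.Binary.PropositionalEquality using (_≡_; cong; trans)

open PartitionFunction using (Z-positive)
open ClosedForm

private
  degree : ∀ r N → 2 * r + 2 * suc N ≡ 2 * (r + N) + 2
  degree = ℕ-Solver.solve-∀

theorem14 : (n r : ℕ) → n ≥ 1 →
    Mbar n (2 * r) 0 2
    ≡ ((+ (2 ^ (2 * r) * n * ((2 * n) C n))) ÷ℕ (2 * ((2 * r + 2 * n ∸ 2) C (r + n ∸ 1))))
    - (+ (2 * (n ∸ 1))) ÷ℕ 1
theorem14 (suc N) r _
  -- With n = N + 1 the truncated subtractions are exact and give the arguments 2 (r + N) and r + N.
  rewrite trans (cong (_∸ 2) (degree r N)) (ℕ.m+n∸n≡m (2 * (r + N)) 2) | cong (_∸ 1) (ℕ.+-suc r N)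
  = ÷-difference (κdZ (suc N) (2 * r) 0 2) (Z (suc N) (2 * r) 0 2) _ _ (2 * N)
      (Z-positive (suc N) r) (Y-positive N r) (mean-cross N r)
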